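{- For every finite ground set $N=\{e_1,\dots,e_n\}$, let $\mathcal{F}=\{S\subseteq N : |S|\le 1\}$ and $\mathcal{P}=\{x\in[0,1]^n : \sum_{i=1}^n x_i\le 1\}$ (the single-item setting). There exists a (randomized) greedy OCRS for $\mathcal{P}$ that is $\frac{1}{e}$-selectable; that is, for every $x\in\mathcal{P}$ there is a random down-closed family $\mathcal{F}_x\subseteq\mathcal{F}$ such that $$\Pr\left[I\cup\{e\}\in\mathcal{F}_x \ \text{ for all } I\subseteq R(x) \text{ with } I\in\mathcal{F}_x\right]\ \ge\ \frac{1}{e}\qquad\text{for all } e\in N .$$
   Context: Let $N$ be a finite ground set, $\mathcal{F}\subseteq 2^N$ a family of feasible sets and $\mathcal{P}\subseteq[0,1]^N$ a polyhedral relaxation of $\mathcal{F}$, i.e. a polyhedron containing the characteristic vector of each $S\in\mathcal{F}$. For $x\in\mathcal{P}$, $R(x)\subseteq N$ is the random set of active elements, in which each $e_i$ appears independently with probability $x_i$. Elements arrive one by one, revealing whether they are active, and an online contention resolution scheme (OCRS) must immediately and irrevocably decide whether to select each active element, keeping the selected set feasible. A greedy OCRS for $\mathcal{P}$ specifies, for each $x\in\mathcal{P}$, a down-closed family $\mathcal{F}_x\subseteq\mathcal{F}$ before the online process starts, and then selects an arriving active element whenever it, together with the elements already selected, forms a set in $\mathcal{F}_x$. It is randomized if, given $x$, the choice of $\mathcal{F}_x$ is random (drawn independently of $R(x)$). A greedy OCRS is $c$-selectable ($c\in[0,1]$) if for every $x\in\mathcal{P}$ and every $e\in N$, $\Pr[I\cup\{e\}\in\mathcal{F}_x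 \text{ for all } I\subseteq R(x) \text{ with } I\in\mathcal{F}_x]\ge c$, the probability being over both $R(x)$ and the random choice of $\mathcal{F}_x$. -}

module Defs where

open import Level using (0ℓ)
open import Data.Bool.Base using (Bool; T; if_then_else_)
import Data.Bool.Properties as Bool
open import Data.Fin.Base using (Fin)
open import Data.Fin.Subset
  using (Subset; inside; outside; _⊆_; _∪_; ⁅_⁆; ⊥; ∣_∣)
open import Data.Fin.Subset.Properties using (_⊆?_; anySubset?)
open import Data.Integer.Base as ℤ using (+_)
import Data.Integer.Properties as ℤ
open import Data.Nat.Base as ℕ using (ℕ; zero; suc; _!)
import Data.Nat.Properties as ℕ
open import Data.Product.Base using (∃; _×_; _,_)
open import Data.Rational.Base as ℚ using (ℚ; 0ℚ; 1ℚ; mkℚ)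
import Data.Rational.Properties as ℚ
open import Data.Rational.Solver using (module +-*-Solver)
import Data.Rational.Unnormalised.Base as ℚᵘ
import Data.Rational.Unnormalised.Properties as ℚᵘ
open import Data.Sum.Base using (inj₁; inj₂)
open import Data.Vec.Base using ([]; _∷_; lookup)
open import Data.Vec.Functional using (Vector; foldr)
open import Relation.Binary.PropositionalEquality
open import Relation.Nullary using (Dec; does; ¬?)
open import Relation.Nullary.Decidable using (map′; decidable-stable; _→-dec_; T?)
open import Relation.Unary using (Pred; Decidable)

------------------------------------------------------------------------
-- Real numbers: Cauchy sequences of rationals (each carrying its modulus
-- of convergence), considered up to _≃_.  Operations are pointwise.

IsCauchy : (ℕ → ℚ) → Set
IsCauchy s = ∀ ε → 0ℚ ℚ.< ε →
  ∃ λ N → ∀ m n → N ℕ.≤ m → N ℕ.≤ n → ℚ.∣ s m ℚ.- s n ∣ ℚ.< ε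

record ℝ : Set where
  constructor mkℝ
  field
    seq    : ℕ → ℚ
    cauchy : IsCauchy seq

open ℝ public

infix 4 _≃_ _≤_

_≃_ : ℝ → ℝ → Set
x ≃ y = ∀ ε → 0ℚ ℚ.< ε →
  ∃ λ N → ∀ n → N ℕ.≤ n → ℚ.∣ seq x n ℚ.- seq y n ∣ ℚ.< ε

_≤_ : ℝ → ℝ → Set
x ≤ y = ∀ ε → 0ℚ ℚ.< ε →
  ∃ λ N → ∀ n → N ℕ.≤ n → seq x n ℚ.< seq y n ℚ.+ ε

private
  module _ where
    open +-*-Solver

    sub-swap : ∀ a b → b ℚ.- a ≡ ℚ.- (a ℚ.- b)
    sub-swap = solve 2 (λ a b → b :- a := :- (a :- b)) refl

    sub-sum : ∀ a b c d →
      (a ℚ.+ b) ℚ.- (c ℚ.+ d) ≡ (a ℚ.- c) ℚ.+ (b ℚ.- d)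
    sub-sum = solve 4
      (λ a b c d → (a :+ b) :- (c :+ d) := (a :- c) :+ (b :- d)) refl

    sub-neg : ∀ a b → (ℚ.- a) ℚ.- (ℚ.- b) ≡ ℚ.- (a ℚ.- b)
    sub-neg = solve 2 (λ a b → (:- a) :- (:- b) := :- (a :- b)) refl

    sub-prod : ∀ a b c d →
      (a ℚ.* b) ℚ.- (c ℚ.* d) ≡ (a ℚ.* (b ℚ.- d)) ℚ.+ ((a ℚ.- c) ℚ.* d)
    sub-prod = solve 4
      (λ a b c d → (a :* b) :- (c :* d)
                   := (a :* (b :- d)) :+ ((a :- c) :* d)) refl

    sub-add : ∀ a b → (a ℚ.- b) ℚ.+ b ≡ a
    sub-add = solve 2 (λ a b → (a :- b) :+ b := a) refl

    add-sub : ∀ a b → (a ℚ.+ b) ℚ.- a ≡ b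
    add-sub = solve 2 (λ a b → (a :+ b) :- a := b) refl

    recip-diff : ∀ p q a b →
      (p ℚ.* q) ℚ.* (b ℚ.- a)
        ≡ ((q ℚ.* b) ℚ.* p) ℚ.- ((p ℚ.* a) ℚ.* q)
    recip-diff = solve 4
      (λ p q a b → (p :* q) :* (b :- a)
                   := ((q :* b) :* p) :- ((p :* a) :* q)) refl

  dist-sym : ∀ a b → ℚ.∣ a ℚ.- b ∣ ≡ ℚ.∣ b ℚ.- a ∣
  dist-sym a b = sym (trans (cong ℚ.∣_∣ (sub-swap a b)) (ℚ.∣-p∣≡∣p∣ (a ℚ.- b)))

  pos-½* : ∀ {ε} → 0ℚ ℚ.< ε → 0ℚ ℚ.< ℚ.½ ℚ.* ε
  pos-½* 0<ε = ℚ.*-monoʳ-<-pos ℚ.½ 0<ε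

  ½+½ : ∀ ε → (ℚ.½ ℚ.* ε) ℚ.+ (ℚ.½ ℚ.* ε) ≡ ε
  ½+½ ε = trans (sym (ℚ.*-distribʳ-+ ε ℚ.½ ℚ.½)) (ℚ.*-identityˡ ε)

  0<1 : 0ℚ ℚ.< 1ℚ
  0<1 = ℚ.positive⁻¹ 1ℚ

  abstract
    cauchy-const : ∀ q → IsCauchy (λ _ → q)
    cauchy-const q ε 0<ε = 0 , λ _ _ _ _ →
      subst (ℚ._< ε) (sym (cong ℚ.∣_∣ (ℚ.+-inverseʳ q))) 0<ε

    cauchy-+ : ∀ s t → IsCauchy s → IsCauchy t → IsCauchy (λ n → s n ℚ.+ t n)
    cauchy-+ s t cs ct ε 0<ε
      with cs (ℚ.½ ℚ.* ε) (pos-½* 0<ε) | ct (ℚ.½ ℚ.* ε) (pos-½* 0<ε)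
    ... | N , hs | M , ht = N ℕ.⊔ M , λ m n lm ln →
      begin-strict
        ℚ.∣ (s m ℚ.+ t m) ℚ.- (s n ℚ.+ t n) ∣
          ≡⟨ cong ℚ.∣_∣ (sub-sum (s m) (t m) (s n) (t n)) ⟩
        ℚ.∣ (s m ℚ.- s n) ℚ.+ (t m ℚ.- t n) ∣
          ≤⟨ ℚ.∣p+q∣≤∣p∣+∣q∣ (s m ℚ.- s n) (t m ℚ.- t n) ⟩
        ℚ.∣ s m ℚ.- s n ∣ ℚ.+ ℚ.∣ t m ℚ.- t n ∣
          <⟨ ℚ.+-mono-< (hs m n (ℕ.m⊔n≤o⇒m≤o N M lm) (ℕ.m⊔n≤o⇒m≤o N M ln))
                        (ht m n (ℕ.m⊔n≤o⇒n≤o N M lm) (ℕ.m⊔n≤o⇒n≤o N M ln)) ⟩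
        (ℚ.½ ℚ.* ε) ℚ.+ (ℚ.½ ℚ.* ε)
          ≡⟨ ½+½ ε ⟩
        ε ∎
      where open ℚ.≤-Reasoning

    cauchy-neg : ∀ s → IsCauchy s → IsCauchy (λ n → ℚ.- s n)
    cauchy-neg s cs ε 0<ε with cs ε 0<ε
    ... | N , hs = N , λ m n lm ln →
      subst (ℚ._< ε)
        (sym (trans (cong ℚ.∣_∣ (sub-neg (s m) (s n))) (ℚ.∣-p∣≡∣p∣ (s m ℚ.- s n))))
        (hs m n lm ln)

  cauchy-bounded : ∀ {s} → IsCauchy s →
    ∃ λ B → 0ℚ ℚ.< B × ∃ λ N → ∀ n → N ℕ.≤ n → ℚ.∣ s n ∣ ℚ.≤ B
  cauchy-bounded {s} cs with cs 1ℚ 0<1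
  ... | N , h = 1ℚ ℚ.+ ℚ.∣ s N ∣ , ℚ.+-mono-<-≤ 0<1 (ℚ.0≤∣p∣ (s N)) , N , λ n ln →
    begin
      ℚ.∣ s n ∣                          ≡⟨ cong ℚ.∣_∣ (sub-add (s n) (s N)) ⟨
      ℚ.∣ (s n ℚ.- s N) ℚ.+ s N ∣        ≤⟨ ℚ.∣p+q∣≤∣p∣+∣q∣ (s n ℚ.- s N) (s N) ⟩
      ℚ.∣ s n ℚ.- s N ∣ ℚ.+ ℚ.∣ s N ∣    ≤⟨ ℚ.+-monoˡ-≤ ℚ.∣ s N ∣
                                             (ℚ.<⇒≤ (h n N ln ℕ.≤-refl)) ⟩
      1ℚ ℚ.+ ℚ.∣ s N ∣ ∎
    where open ℚ.≤-Reasoning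

  *-mono-abs : ∀ p q {a b} → ℚ.∣ p ∣ ℚ.≤ a → ℚ.∣ q ∣ ℚ.≤ b →
               ℚ.∣ p ℚ.* q ∣ ℚ.≤ a ℚ.* b
  *-mono-abs p q {a} {b} p≤a q≤b = begin
    ℚ.∣ p ℚ.* q ∣          ≡⟨ ℚ.∣p*q∣≡∣p∣*∣q∣ p q ⟩
    ℚ.∣ p ∣ ℚ.* ℚ.∣ q ∣    ≤⟨ ℚ.*-monoʳ-≤-nonNeg ℚ.∣ q ∣ {{ℚ.∣-∣-nonNeg q}} p≤a ⟩
    a ℚ.* ℚ.∣ q ∣          ≤⟨ ℚ.*-monoˡ-≤-nonNeg a
                                {{ℚ.nonNegative (ℚ.≤-trans (ℚ.0≤∣p∣ p) p≤a)}} q≤b ⟩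
    a ℚ.* b ∎
    where open ℚ.≤-Reasoning

  scale : ∀ B C ε → 0ℚ ℚ.< B → 0ℚ ℚ.< C → 0ℚ ℚ.< ε →
          ∃ λ δ → 0ℚ ℚ.< δ × (B ℚ.* δ) ℚ.+ (δ ℚ.* C) ≡ ε
  scale B C ε 0<B 0<C 0<ε = δ , 0<δ , eq
    where
    open ≡-Reasoning
    D = B ℚ.+ C
    D-pos : ℚ.Positive D
    D-pos = ℚ.positive (ℚ.+-mono-< 0<B 0<C)
    D-nz : ℚ.NonZero D
    D-nz = ℚ.pos⇒nonZero D {{D-pos}}
    r = (ℚ.1/ D) {{D-nz}}
    δ = r ℚ.* ε
    0<δ : 0ℚ ℚ.< δ
    0<δ = ℚ.positive⁻¹ δ
      {{ℚ.pos*pos⇒pos r {{ℚ.1/pos⇒pos D {{D-pos}}}} ε {{ℚ.positive 0<ε}}}}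
    eq : (B ℚ.* δ) ℚ.+ (δ ℚ.* C) ≡ ε
    eq = begin
      (B ℚ.* δ) ℚ.+ (δ ℚ.* C)  ≡⟨ cong ((B ℚ.* δ) ℚ.+_) (ℚ.*-comm δ C) ⟩
      (B ℚ.* δ) ℚ.+ (C ℚ.* δ)  ≡⟨ ℚ.*-distribʳ-+ δ B C ⟨
      D ℚ.* δ                  ≡⟨ ℚ.*-assoc D r ε ⟨
      (D ℚ.* r) ℚ.* ε          ≡⟨ cong (ℚ._* ε) (ℚ.*-inverseʳ D {{D-nz}}) ⟩
      1ℚ ℚ.* ε                 ≡⟨ ℚ.*-identityˡ ε ⟩
      ε ∎

  prod-dist : ∀ a b c d {B C δ} → ℚ.∣ a ∣ ℚ.≤ B → ℚ.∣ d ∣ ℚ.≤ C →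
              ℚ.∣ b ℚ.- d ∣ ℚ.≤ δ → ℚ.∣ a ℚ.- c ∣ ℚ.≤ δ →
              ℚ.∣ (a ℚ.* b) ℚ.- (c ℚ.* d) ∣ ℚ.≤ (B ℚ.* δ) ℚ.+ (δ ℚ.* C)
  prod-dist a b c d {B} {C} {δ} a≤B d≤C bd ac = begin
    ℚ.∣ (a ℚ.* b) ℚ.- (c ℚ.* d) ∣
      ≡⟨ cong ℚ.∣_∣ (sub-prod a b c d) ⟩
    ℚ.∣ (a ℚ.* (b ℚ.- d)) ℚ.+ ((a ℚ.- c) ℚ.* d) ∣
      ≤⟨ ℚ.∣p+q∣≤∣p∣+∣q∣ (a ℚ.* (b ℚ.- d)) ((a ℚ.- c) ℚ.* d) ⟩
    ℚ.∣ a ℚ.* (b ℚ.- d) ∣ ℚ.+ ℚ.∣ (a ℚ.- c) ℚ.* d ∣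
      ≤⟨ ℚ.+-mono-≤ (*-mono-abs a (b ℚ.- d) a≤B bd)
                    (*-mono-abs (a ℚ.- c) d ac d≤C) ⟩
    (B ℚ.* δ) ℚ.+ (δ ℚ.* C) ∎
    where open ℚ.≤-Reasoning

  ½ε<ε : ∀ ε → 0ℚ ℚ.< ε → ℚ.½ ℚ.* ε ℚ.< ε
  ½ε<ε ε 0<ε = subst₂ ℚ._<_ (ℚ.+-identityʳ (ℚ.½ ℚ.* ε)) (½+½ ε)
    (ℚ.+-monoʳ-< (ℚ.½ ℚ.* ε) (pos-½* 0<ε))

  abstract
    cauchy-* : ∀ s t → IsCauchy s → IsCauchy t → IsCauchy (λ n → s n ℚ.* t n)
    cauchy-* s t cs ct ε 0<ε =
      let B , 0<B , K , hB = cauchy-bounded cs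
          C , 0<C , L , hC = cauchy-bounded ct
          δ , 0<δ , eq     = scale B C (ℚ.½ ℚ.* ε) 0<B 0<C (pos-½* 0<ε)
          N , hs           = cs δ 0<δ
          M , ht           = ct δ 0<δ
      in combine B C δ (subst (ℚ._< ε) (sym eq) (½ε<ε ε 0<ε)) K L N M hB hC hs ht
      where
      combine : ∀ B C δ → (B ℚ.* δ) ℚ.+ (δ ℚ.* C) ℚ.< ε → ∀ K L N M →
        (∀ n → K ℕ.≤ n → ℚ.∣ s n ∣ ℚ.≤ B) →
        (∀ n → L ℕ.≤ n → ℚ.∣ t n ∣ ℚ.≤ C) →
        (∀ m n → N ℕ.≤ m → N ℕ.≤ n → ℚ.∣ s m ℚ.- s n ∣ ℚ.< δ) →
        (∀ m n → M ℕ.≤ m → M ℕ.≤ n → ℚ.∣ t m ℚ.- t n ∣ ℚ.< δ) →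
        ∃ λ P → ∀ m n → P ℕ.≤ m → P ℕ.≤ n →
          ℚ.∣ (s m ℚ.* t m) ℚ.- (s n ℚ.* t n) ∣ ℚ.< ε
      combine B C δ small K L N M hB hC hs ht =
        (K ℕ.⊔ L) ℕ.⊔ (N ℕ.⊔ M) , λ m n lm ln → ℚ.≤-<-trans
          (prod-dist (s m) (t m) (s n) (t n)
            (hB m (ℕ.m⊔n≤o⇒m≤o K L (left lm)))
            (hC n (ℕ.m⊔n≤o⇒n≤o K L (left ln)))
            (ℚ.<⇒≤ (ht m n (ℕ.m⊔n≤o⇒n≤o N M (right lm))
                           (ℕ.m⊔n≤o⇒n≤o N M (right ln))))
            (ℚ.<⇒≤ (hs m n (ℕ.m⊔n≤o⇒m≤o N M (right lm))
                           (ℕ.m⊔n≤o⇒m≤o N M (right ln)))))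
          small
        where
        left : ∀ {i} → (K ℕ.⊔ L) ℕ.⊔ (N ℕ.⊔ M) ℕ.≤ i → K ℕ.⊔ L ℕ.≤ i
        left = ℕ.m⊔n≤o⇒m≤o (K ℕ.⊔ L) (N ℕ.⊔ M)
        right : ∀ {i} → (K ℕ.⊔ L) ℕ.⊔ (N ℕ.⊔ M) ℕ.≤ i → N ℕ.⊔ M ℕ.≤ i
        right = ℕ.m⊔n≤o⇒n≤o (K ℕ.⊔ L) (N ℕ.⊔ M)

infixl 6 _+_ _-_
infixl 7 _*_

fromℚ : ℚ → ℝ
fromℚ q = mkℝ (λ _ → q) (cauchy-const q)

0ℝ 1ℝ : ℝ
0ℝ = fromℚ 0ℚ
1ℝ = fromℚ 1ℚ

_+_ _*_ _-_ : ℝ → ℝ → ℝ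
x + y = mkℝ (λ n → seq x n ℚ.+ seq y n) (cauchy-+ (seq x) (seq y) (cauchy x) (cauchy y))
x * y = mkℝ (λ n → seq x n ℚ.* seq y n) (cauchy-* (seq x) (seq y) (cauchy x) (cauchy y))
x - y = mkℝ (λ n → seq x n ℚ.- seq y n)
            (cauchy-+ (seq x) (λ n → ℚ.- seq y n)
              (cauchy x) (cauchy-neg (seq y) (cauchy y)))

∑ ∏ : ∀ {n} → Vector ℝ n → ℝ
∑ = foldr _+_ 0ℝ
∏ = foldr _*_ 1ℝ

------------------------------------------------------------------------
-- The constants e = ∑ₖ 1/k! and 1/e

1/_! : ℕ → ℚ
1/ k ! = (+ 1 ℚ./ k !) {{k ℕ.!≢0}}

e-partial : ℕ → ℚ
e-partial zero    = 1/ 0 !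
e-partial (suc n) = e-partial n ℚ.+ 1/ suc n !

private
  toℚᵘ-1/ : ∀ d → ℚ.toℚᵘ (+ 1 ℚ./ suc d) ℚᵘ.≃ ℚᵘ.mkℚᵘ (+ 1) d
  toℚᵘ-1/ d = ℚ.toℚᵘ-fromℚᵘ (ℚᵘ.mkℚᵘ (+ 1) d)

  1/-halve : ∀ a b {{_ : ℕ.NonZero a}} {{_ : ℕ.NonZero b}} → 2 ℕ.* a ℕ.≤ b →
             (+ 1 ℚ./ b) ℚ.+ (+ 1 ℚ./ b) ℚ.≤ + 1 ℚ./ a
  1/-halve (suc a) (suc b) 2a≤b = ℚ.toℚᵘ-cancel-≤ (begin
    ℚ.toℚᵘ ((+ 1 ℚ./ suc b) ℚ.+ (+ 1 ℚ./ suc b))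
      ≃⟨ ℚ.toℚᵘ-homo-+ (+ 1 ℚ./ suc b) (+ 1 ℚ./ suc b) ⟩
    ℚ.toℚᵘ (+ 1 ℚ./ suc b) ℚᵘ.+ ℚ.toℚᵘ (+ 1 ℚ./ suc b)
      ≃⟨ ℚᵘ.+-cong (toℚᵘ-1/ b) (toℚᵘ-1/ b) ⟩
    ℚᵘ.mkℚᵘ (+ 1) b ℚᵘ.+ ℚᵘ.mkℚᵘ (+ 1) b
      ≤⟨ ℚᵘ.*≤* (subst₂ ℤ._≤_ (ℤ.pos-* (1 ℕ.* suc b ℕ.+ 1 ℕ.* suc b) (suc a))
                              (ℤ.pos-* 1 (suc b ℕ.* suc b)) (ℤ.+≤+ core)) ⟩
    ℚᵘ.mkℚᵘ (+ 1) a
      ≃⟨ ℚᵘ.≃-sym (toℚᵘ-1/ a) ⟩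
    ℚ.toℚᵘ (+ 1 ℚ./ suc a) ∎)
    where
    open ℚᵘ.≤-Reasoning
    core : (1 ℕ.* suc b ℕ.+ 1 ℕ.* suc b) ℕ.* suc a ℕ.≤ 1 ℕ.* (suc b ℕ.* suc b)
    core = R.begin
      (1 ℕ.* suc b ℕ.+ 1 ℕ.* suc b) ℕ.* suc a
        R.≡⟨ cong (λ z → (z ℕ.+ z) ℕ.* suc a) (ℕ.*-identityˡ (suc b)) ⟩
      (suc b ℕ.+ suc b) ℕ.* suc a
        R.≡⟨ cong (λ z → (suc b ℕ.+ z) ℕ.* suc a) (sym (ℕ.+-identityʳ (suc b))) ⟩
      (2 ℕ.* suc b) ℕ.* suc a
        R.≡⟨ cong (ℕ._* suc a) (ℕ.*-comm 2 (suc b)) ⟩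
      (suc b ℕ.* 2) ℕ.* suc a
        R.≡⟨ ℕ.*-assoc (suc b) 2 (suc a) ⟩
      suc b ℕ.* (2 ℕ.* suc a)
        R.≤⟨ ℕ.*-monoʳ-≤ (suc b) 2a≤b ⟩
      suc b ℕ.* suc b
        R.≡⟨ sym (ℕ.*-identityˡ (suc b ℕ.* suc b)) ⟩
      1 ℕ.* (suc b ℕ.* suc b) R.∎
      where module R = ℕ.≤-Reasoning

  n≤n! : ∀ n → n ℕ.≤ n !
  n≤n! zero    = ℕ.z≤n
  n≤n! (suc n) = ℕ.m≤m*n (suc n) (n !) {{n ℕ.!≢0}}

  1/-small : ∀ p (d : ℕ) {{_ : ℕ.NonZero d}} → 0ℚ ℚ.< p →
             ℚ.↧ₙ p ℕ.< d → + 1 ℚ./ d ℚ.< p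
  1/-small (mkℚ (+ zero) q _)    d (ℚ.*<* (ℤ.+<+ ())) _
  1/-small (mkℚ ℤ.-[1+ k ] q _)  d (ℚ.*<* ()) _
  1/-small p@(mkℚ (+ (suc k)) q _) (suc d) _ q<d = ℚ.toℚᵘ-cancel-< (begin-strict
    ℚ.toℚᵘ (+ 1 ℚ./ suc d)  ≃⟨ toℚᵘ-1/ d ⟩
    ℚᵘ.mkℚᵘ (+ 1) d         <⟨ ℚᵘ.*<* (subst₂ ℤ._<_ (ℤ.pos-* 1 (suc q))
                                 (ℤ.pos-* (suc k) (suc d)) (ℤ.+<+ core)) ⟩
    ℚᵘ.mkℚᵘ (+ (suc k)) q   ∎)
    where
    open ℚᵘ.≤-Reasoning
    core : 1 ℕ.* suc q ℕ.< suc k ℕ.* suc d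
    core = ℕ.<-≤-trans (subst (ℕ._< suc d) (sym (ℕ.*-identityˡ (suc q))) q<d)
                       (ℕ.m≤n*m (suc d) (suc k))

  1/!-small : ∀ p n → 0ℚ ℚ.< p → ℚ.↧ₙ p ℕ.< n → 1/ n ! ℚ.< p
  1/!-small p n 0<p l =
    1/-small p (n !) {{n ℕ.!≢0}} 0<p (ℕ.<-≤-trans l (n≤n! n))

  1/!-pos : ∀ n → 0ℚ ℚ.< 1/ n !
  1/!-pos n = go (n !) {{n ℕ.!≢0}}
    where
    go : ∀ d {{_ : ℕ.NonZero d}} → 0ℚ ℚ.< + 1 ℚ./ d
    go d = ℚ.positive⁻¹ (+ 1 ℚ./ d) {{ℚ.normalize-pos 1 d}}

  1/!-halve : ∀ n → 1 ℕ.≤ n → 1/ suc n ! ℚ.+ 1/ suc n ! ℚ.≤ 1/ n !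
  1/!-halve n 1≤n =
    1/-halve (n !) (suc n !) {{n ℕ.!≢0}} {{suc n ℕ.!≢0}}
      (ℕ.*-monoˡ-≤ (n !) (ℕ.s≤s 1≤n))

  e-partial-step : ∀ n → e-partial n ℚ.≤ e-partial (suc n)
  e-partial-step n = subst (ℚ._≤ e-partial (suc n)) (ℚ.+-identityʳ (e-partial n))
    (ℚ.+-monoʳ-≤ (e-partial n) (ℚ.<⇒≤ (1/!-pos (suc n))))

  e-partial-mono : ∀ n k → e-partial n ℚ.≤ e-partial (k ℕ.+ n)
  e-partial-mono n zero    = ℚ.≤-refl
  e-partial-mono n (suc k) = ℚ.≤-trans (e-partial-mono n k) (e-partial-step (k ℕ.+ n))

  e-upper : ∀ n k → 1 ℕ.≤ n →
    e-partial (k ℕ.+ n) ℚ.+ 1/ (k ℕ.+ n) ! ℚ.≤ e-partial n ℚ.+ 1/ n !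
  e-upper n zero    1≤n = ℚ.≤-refl
  e-upper n (suc k) 1≤n = begin
    (e-partial m ℚ.+ 1/ suc m !) ℚ.+ 1/ suc m !
      ≡⟨ ℚ.+-assoc (e-partial m) (1/ suc m !) (1/ suc m !) ⟩
    e-partial m ℚ.+ (1/ suc m ! ℚ.+ 1/ suc m !)
      ≤⟨ ℚ.+-monoʳ-≤ (e-partial m)
           (1/!-halve m (ℕ.≤-trans 1≤n (ℕ.m≤n+m n k))) ⟩
    e-partial m ℚ.+ 1/ m !
      ≤⟨ e-upper n k 1≤n ⟩
    e-partial n ℚ.+ 1/ n ! ∎
    where
    open ℚ.≤-Reasoning
    m = k ℕ.+ n

  e-dist : ∀ m n → 1 ℕ.≤ n → n ℕ.≤ m →
           ℚ.∣ e-partial m ℚ.- e-partial n ∣ ℚ.≤ 1/ n !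
  e-dist m n 1≤n n≤m with ℕ.m∸n+n≡m n≤m
  ... | eq = subst (λ i → ℚ.∣ e-partial i ℚ.- e-partial n ∣ ℚ.≤ 1/ n !) eq (begin
    ℚ.∣ e-partial i ℚ.- e-partial n ∣
      ≡⟨ ℚ.0≤p⇒∣p∣≡p (subst (ℚ._≤ e-partial i ℚ.- e-partial n)
           (ℚ.+-inverseʳ (e-partial n))
           (ℚ.+-monoˡ-≤ (ℚ.- e-partial n) (e-partial-mono n (m ℕ.∸ n)))) ⟩
    e-partial i ℚ.- e-partial n
      ≤⟨ ℚ.+-monoˡ-≤ (ℚ.- e-partial n) upper ⟩
    (e-partial n ℚ.+ 1/ n !) ℚ.- e-partial n
      ≡⟨ add-sub (e-partial n) (1/ n !) ⟩
    1/ n ! ∎)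
    where
    open ℚ.≤-Reasoning
    i = m ℕ.∸ n ℕ.+ n
    upper : e-partial i ℚ.≤ e-partial n ℚ.+ 1/ n !
    upper = ℚ.≤-trans
      (subst (ℚ._≤ e-partial i ℚ.+ 1/ i !) (ℚ.+-identityʳ (e-partial i))
        (ℚ.+-monoʳ-≤ (e-partial i) (ℚ.<⇒≤ (1/!-pos i))))
      (e-upper n (m ℕ.∸ n) 1≤n)

  abstract
    e-cauchy : IsCauchy e-partial
    e-cauchy ε 0<ε = suc (ℚ.↧ₙ ε) , go
      where
      bound : ∀ m n → suc (ℚ.↧ₙ ε) ℕ.≤ n → n ℕ.≤ m →
              ℚ.∣ e-partial m ℚ.- e-partial n ∣ ℚ.< ε
      bound m n l n≤m = ℚ.≤-<-trans
        (e-dist m n (ℕ.≤-trans (ℕ.s≤s ℕ.z≤n) l) n≤m) (1/!-small ε n 0<ε l)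
      go : ∀ m n → suc (ℚ.↧ₙ ε) ℕ.≤ m → suc (ℚ.↧ₙ ε) ℕ.≤ n →
           ℚ.∣ e-partial m ℚ.- e-partial n ∣ ℚ.< ε
      go m n lm ln with ℕ.≤-total n m
      ... | inj₁ n≤m = bound m n ln n≤m
      ... | inj₂ m≤n = subst (ℚ._< ε) (dist-sym (e-partial n) (e-partial m))
                             (bound n m lm m≤n)

e : ℝ
e = mkℝ e-partial e-cauchy

1≤e-partial : ∀ n → 1ℚ ℚ.≤ e-partial n
1≤e-partial zero    = ℚ.≤-refl
1≤e-partial (suc n) = ℚ.≤-trans (1≤e-partial n) (e-partial-step n)

e-partial-nonZero : ∀ n → ℚ.NonZero (e-partial n)
e-partial-nonZero n = ℚ.>-nonZero (ℚ.<-≤-trans 0<1 (1≤e-partial n))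

private
  recip : ℕ → ℚ
  recip n = (ℚ.1/ e-partial n) {{e-partial-nonZero n}}

  recip-inv : ∀ n → recip n ℚ.* e-partial n ≡ 1ℚ
  recip-inv n = ℚ.*-inverseˡ (e-partial n) {{e-partial-nonZero n}}

  ∣recip∣≤1 : ∀ n → ℚ.∣ recip n ∣ ℚ.≤ 1ℚ
  ∣recip∣≤1 n = begin
    ℚ.∣ recip n ∣            ≡⟨ ℚ.0≤p⇒∣p∣≡p (ℚ.<⇒≤ (ℚ.positive⁻¹ (recip n))) ⟩
    recip n                  ≡⟨ ℚ.*-identityʳ (recip n) ⟨
    recip n ℚ.* 1ℚ           ≤⟨ ℚ.*-monoˡ-≤-nonNeg (recip n)
                                  {{ℚ.pos⇒nonNeg (recip n)}} (1≤e-partial n) ⟩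
    recip n ℚ.* e-partial n  ≡⟨ recip-inv n ⟩
    1ℚ ∎
    where
    open ℚ.≤-Reasoning
    instance
      recip-pos : ℚ.Positive (recip n)
      recip-pos = ℚ.1/pos⇒pos (e-partial n)
        {{ℚ.positive (ℚ.<-≤-trans 0<1 (1≤e-partial n))}}

  abstract
    recip-cauchy : IsCauchy recip
    recip-cauchy ε 0<ε with e-cauchy ε 0<ε
    ... | N , h = N , λ m n lm ln → begin-strict
      ℚ.∣ recip m ℚ.- recip n ∣
        ≡⟨ cong ℚ.∣_∣ (diff m n) ⟨
      ℚ.∣ (recip m ℚ.* recip n) ℚ.* (e-partial n ℚ.- e-partial m) ∣
        ≤⟨ *-mono-abs (recip m ℚ.* recip n) (e-partial n ℚ.- e-partial m)
             (*-mono-abs (recip m) (recip n) (∣recip∣≤1 m) (∣recip∣≤1 n)) ℚ.≤-refl ⟩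
      (1ℚ ℚ.* 1ℚ) ℚ.* ℚ.∣ e-partial n ℚ.- e-partial m ∣
        ≡⟨ ℚ.*-identityˡ ℚ.∣ e-partial n ℚ.- e-partial m ∣ ⟩
      ℚ.∣ e-partial n ℚ.- e-partial m ∣
        <⟨ h n m ln lm ⟩
      ε ∎
      where
      open ℚ.≤-Reasoning
      diff : ∀ m n → (recip m ℚ.* recip n) ℚ.* (e-partial n ℚ.- e-partial m)
                     ≡ recip m ℚ.- recip n
      diff m n = trans (recip-diff (recip m) (recip n) (e-partial m) (e-partial n))
        (cong₂ ℚ._-_
          (trans (cong (ℚ._* recip m) (recip-inv n)) (ℚ.*-identityˡ (recip m)))
          (trans (cong (ℚ._* recip n) (recip-inv m)) (ℚ.*-identityˡ (recip n))))

1/e : ℝ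
1/e = mkℝ (λ n → (ℚ.1/ e-partial n) {{e-partial-nonZero n}}) recip-cauchy

1/e*e≃1 : 1/e * e ≃ 1ℝ
1/e*e≃1 ε 0<ε = 0 , λ n _ →
  subst (ℚ._< ε) (sym (cong (λ z → ℚ.∣ z ℚ.- 1ℚ ∣) (recip-inv n))) 0<ε

------------------------------------------------------------------------
-- Finite probability

𝟙 : ∀ {A : Set} → Dec A → ℝ
𝟙 d = if does d then 1ℝ else 0ℝ

-- A random element of A with finite support; outcomes may repeat.  For
-- families of subsets of a finite set finite support is no restriction.
record Random (A : Set) : Set where
  field
    size     : ℕ
    outcome  : Fin size → A
    prob     : Vector ℝ size
    prob≥0   : ∀ k → 0ℝ ≤ prob k
    ∑prob≃1  : ∑ prob ≃ 1ℝ

Pr : ∀ {A : Set} {Q : Pred A 0ℓ} → Random A → Decidable Q → ℝ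
Pr X Q? = ∑ λ k → prob k * 𝟙 (Q? (outcome k))
  where open Random X

∑Subset : ∀ {n} → (Subset n → ℝ) → ℝ
∑Subset {zero}  f = f []
∑Subset {suc n} f = ∑Subset (λ S → f (outside ∷ S)) + ∑Subset (λ S → f (inside ∷ S))

-- Pr[R(x) = S], where each i belongs to R(x) independently with
-- probability x i.
activeProb : ∀ {n} → Vector ℝ n → Subset n → ℝ
activeProb x S = ∏ λ i → if lookup S i then x i else 1ℝ - x i

------------------------------------------------------------------------
-- Greedy online contention resolution schemes on the ground set Fin n

Family : ℕ → Set₁
Family n = Pred (Subset n) 0ℓ

-- ∅∈ rules out the empty family, for which selectability is vacuous.
record GreedyFamily {n} (𝓕 : Family n) : Set where
  field
    member : Subset n → Bool

  infix 4 _∈ᶠ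
  _∈ᶠ : Subset n → Set
  S ∈ᶠ = T (member S)

  field
    feasible   : ∀ {S} → S ∈ᶠ → 𝓕 S
    ∅∈         : ⊥ ∈ᶠ
    downClosed : ∀ {S S′} → S ∈ᶠ → S′ ⊆ S → S′ ∈ᶠ

open GreedyFamily public using (member)

infix 4 _∈ᶠ_
_∈ᶠ_ : ∀ {n} {𝓕 : Family n} → Subset n → GreedyFamily 𝓕 → Set
S ∈ᶠ 𝓖 = GreedyFamily._∈ᶠ 𝓖 S

allSubset? : ∀ {n} {Q : Pred (Subset n) 0ℓ} → Decidable Q → Dec (∀ S → Q S)
allSubset? Q? = map′
  (λ ¬∃ S → decidable-stable (Q? S) λ ¬q → ¬∃ (S , ¬q))
  (λ q (S , ¬q) → ¬q (q S))
  (¬? (anySubset? λ S → ¬? (Q? S)))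

HasMembers : ∀ {n} {𝓕 : Family n} → (Subset n → Bool) → Pred (GreedyFamily 𝓕) 0ℓ
HasMembers h 𝓖 = ∀ S → member 𝓖 S ≡ h S

hasMembers? : ∀ {n} {𝓕 : Family n} (h : Subset n → Bool) →
              Decidable (HasMembers {𝓕 = 𝓕} h)
hasMembers? h 𝓖 = allSubset? λ S → member 𝓖 S Bool.≟ h S

-- Since reals are only considered up to _≃_, the law of F_x must not depend
-- on the sequences representing x (nor on the proof of membership in 𝓟).
record RandomizedGreedyOCRS {n} (𝓕 : Family n) (𝓟 : Pred (Vector ℝ n) 0ℓ) : Set where
  field
    family      : ∀ x → 𝓟 x → Random (GreedyFamily 𝓕)
    family-cong : ∀ x y (x∈𝓟 : 𝓟 x) (y∈𝓟 : 𝓟 y) → (∀ i → x i ≃ y i) →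
                  ∀ h → Pr (family x x∈𝓟) (hasMembers? h)
                      ≃ Pr (family y y∈𝓟) (hasMembers? h)

NeverBlocked : ∀ {n} {𝓕 : Family n} → Fin n → Subset n → Pred (GreedyFamily 𝓕) 0ℓ
NeverBlocked i R 𝓖 = ∀ I → I ⊆ R → I ∈ᶠ 𝓖 → I ∪ ⁅ i ⁆ ∈ᶠ 𝓖

neverBlocked? : ∀ {n} {𝓕 : Family n} (i : Fin n) (R : Subset n) →
                Decidable (NeverBlocked {𝓕 = 𝓕} i R)
neverBlocked? i R 𝓖 = allSubset? λ I →
  (I ⊆? R) →-dec (T? (member 𝓖 I) →-dec T? (member 𝓖 (I ∪ ⁅ i ⁆)))

-- The joint probability over independent R(x) and F_x.
selectProb : ∀ {n} {𝓕 : Family n} → Vector ℝ n → Random (GreedyFamily 𝓕) →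
             Fin n → ℝ
selectProb x F i = ∑Subset λ R → activeProb x R * Pr F (neverBlocked? i R)

Selectable : ∀ {n} {𝓕 : Family n} {𝓟 : Pred (Vector ℝ n) 0ℓ} →
             ℝ → RandomizedGreedyOCRS 𝓕 𝓟 → Set
Selectable {𝓟 = 𝓟} c π = ∀ x (x∈𝓟 : 𝓟 x) i → c ≤ selectProb x (family x x∈𝓟) i
  where open RandomizedGreedyOCRS π

------------------------------------------------------------------------
-- The single-item setting

SingleItem : ∀ n → Family n
SingleItem n S = ∣ S ∣ ℕ.≤ 1

SingleItemPolytope : ∀ n → Pred (Vector ℝ n) 0ℓ
SingleItemPolytope n x =
  (∀ i → 0ℝ ≤ x i) × (∀ i → x i ≤ 1ℝ) × (∑ x ≤ 1ℝ)

{-# OPTIONS --safe #-}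
module Submission where

-- Attenuate each item by q(x) = 1/(1 + x): put i into a random set S independently with probability
-- q(xᵢ) and let F_x consist of the at most one-element subsets of S.  Then i is never blocked with
-- probability q(xᵢ) ∏_{j≠i} (1 − xⱼ q(xⱼ)) = ∏ⱼ 1/(1 + xⱼ), and ∏ⱼ (1 + xⱼ) is at most
-- exp(∑ⱼ xⱼ) ≤ e.  All operations on reals are pointwise, so both steps are inequalities between
-- rationals at each index m, where xⱼ may be slightly negative and ∑ⱼ xⱼ slightly above 1.

open import Algebra.Bundles using (Ring)
open import Algebra.Properties.CommutativeMonoid.Sum using (∑-distrib-+; sum-cong-≗; sum-replicate-zero)
open import Data.Bool.Base using (Bool; true; false; T; not; _∧_; if_then_else_)
import Data.Bool.Properties as Bool
open import Data.Fin.Base using (Fin; zero; suc; _↑ˡ_; _↑ʳ_)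
open import Data.Fin.Properties using (_≟_; all?)
open import Data.Fin.Subset using (Subset; inside; outside; _∈_; _⊆_; _∪_; ⁅_⁆; ⊥; ∣_∣)
import Data.Fin.Subset.Properties as Subset
open import Data.Integer.Base as ℤ using (+_)
import Data.Integer.Properties as ℤ
open import Data.Nat.Base as ℕ using (ℕ; zero; suc; _!)
import Data.Nat.Properties as ℕ
open import Data.Product.Base using (∃; Σ-syntax; _×_; _,_; proj₁; proj₂)
open import Data.Rational.Base as ℚ using (ℚ; 0ℚ; 1ℚ)
import Data.Rational.Properties as ℚ
open import Data.Rational.Solver using (module +-*-Solver)
import Data.Rational.Unnormalised.Base as ℚᵘ
import Data.Rational.Unnormalised.Properties as ℚᵘ
open import Data.Sum.Base using (inj₁; inj₂)
open import Data.Vec.Base using ([]; _∷_; lookup)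
open import Data.Vec.Functional using (Vector; foldr; map; _++_)
open import Data.Vec.Functional.Properties using (lookup-++ˡ; lookup-++ʳ)
open import Data.Vec.Properties using ([]=⇒lookup; lookup⇒[]=)
open import Function.Base using (_∘_)
open import Function.Bundles using (_⇔_; mk⇔; Equivalence)
open import Level using (0ℓ)
open import Relation.Binary.PropositionalEquality
open import Relation.Nullary using (Dec; yes; no; does; contradiction)
open import Relation.Nullary.Decidable using (_×-dec_; T?; ⌊_⌋; toWitness; fromWitness; does-⇔)
open import Relation.Unary using (Pred; Decidable)
open import Defs

open import Algebra.Definitions.RawSemiring ℚ.+-*-rawSemiring using (_^_) renaming (_×_ to _·_)
open import Algebra.Properties.Semiring.Mult (Ring.semiring ℚ.+-*-ring) using (×-assoc-*)

-- The value `q = 1/(1 + x)` is the solution of `q = 1 - x q`. With it, the factor contributed by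
-- `i` itself (the chance of lying in `S`) has the same form as the factor contributed by every
-- other element (the chance of not being both active and in `S`), so a single product bounds all
-- selection probabilities. It is also a rational function, and 1-Lipschitz once the positive part
-- is taken, so it acts on a real index by index and respects `_≃_`.
--
-- The obstacle is that index `m` offers only the truncation `e-partial m`, while the sum of the
-- positive parts is only known to be at most `1 + δ`. A product of `n` factors `1 + b` has degree
-- `n`, so the exponential series may be cut at degree `n`, and for `m ≥ n` all its terms occur in
-- `e-partial m`. Continuity of exp at 1 is replaced by pulling out a factor `(1 + δ) ^ n`, which
-- after inversion costs an additive error of at most `n · δ`, whatever `m` is.

∑ℚ ∏ℚ : ∀ {n} → Vector ℚ n → ℚ
∑ℚ = foldr ℚ._+_ 0ℚ
∏ℚ = foldr ℚ._*_ 1ℚ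

-- Order, products and powers of rationals.

*-mono-≤ : ∀ {a b c d} → 0ℚ ℚ.≤ a → a ℚ.≤ b → 0ℚ ℚ.≤ c → c ℚ.≤ d → a ℚ.* c ℚ.≤ b ℚ.* d
*-mono-≤ {a} {b} {c} {d} 0≤a a≤b 0≤c c≤d = ℚ.≤-trans
  (ℚ.*-monoˡ-≤-nonNeg a {{ℚ.nonNegative 0≤a}} c≤d)
  (ℚ.*-monoʳ-≤-nonNeg d {{ℚ.nonNegative (ℚ.≤-trans 0≤c c≤d)}} a≤b)

*-nonneg : ∀ {a b} → 0ℚ ℚ.≤ a → 0ℚ ℚ.≤ b → 0ℚ ℚ.≤ a ℚ.* b
*-nonneg 0≤a 0≤b = *-mono-≤ ℚ.≤-refl 0≤a ℚ.≤-refl 0≤b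

≤-+-nonneg : ∀ {a b} → 0ℚ ℚ.≤ b → a ℚ.≤ a ℚ.+ b
≤-+-nonneg {a} {b} 0≤b = subst (ℚ._≤ a ℚ.+ b) (ℚ.+-identityʳ a) (ℚ.+-monoʳ-≤ a 0≤b)

0≤1 : 0ℚ ℚ.≤ 1ℚ
0≤1 = ℚ.nonNegative⁻¹ 1ℚ

p≤q⇒0≤q-p : ∀ {p q} → p ℚ.≤ q → 0ℚ ℚ.≤ q ℚ.- p
p≤q⇒0≤q-p {p} {q} p≤q = subst (ℚ._≤ q ℚ.- p) (ℚ.+-inverseʳ p) (ℚ.+-monoˡ-≤ (ℚ.- p) p≤q)

∏-nonneg : ∀ {n} (f : Vector ℚ n) → (∀ i → 0ℚ ℚ.≤ f i) → 0ℚ ℚ.≤ ∏ℚ f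
∏-nonneg {zero}  f 0≤f = 0≤1
∏-nonneg {suc n} f 0≤f = *-nonneg (0≤f zero) (∏-nonneg (f ∘ suc) (0≤f ∘ suc))

∏-mono-≤ : ∀ {n} (f g : Vector ℚ n) → (∀ i → 0ℚ ℚ.≤ f i) → (∀ i → f i ℚ.≤ g i) →
           ∏ℚ f ℚ.≤ ∏ℚ g
∏-mono-≤ {zero}  f g 0≤f f≤g = ℚ.≤-refl
∏-mono-≤ {suc n} f g 0≤f f≤g = *-mono-≤ (0≤f zero) (f≤g zero)
  (∏-nonneg (f ∘ suc) (0≤f ∘ suc)) (∏-mono-≤ (f ∘ suc) (g ∘ suc) (0≤f ∘ suc) (f≤g ∘ suc))

∏-cong : ∀ {n} {f g : Vector ℚ n} → (∀ i → f i ≡ g i) → ∏ℚ f ≡ ∏ℚ g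
∏-cong = sum-cong-≗ ℚ.*-1-commutativeMonoid

∏-distrib-* : ∀ {n} (f g : Vector ℚ n) → ∏ℚ (λ i → f i ℚ.* g i) ≡ ∏ℚ f ℚ.* ∏ℚ g
∏-distrib-* = ∑-distrib-+ ℚ.*-1-commutativeMonoid

∑ℚ-cong : ∀ {n} {f g : Vector ℚ n} → (∀ i → f i ≡ g i) → ∑ℚ f ≡ ∑ℚ g
∑ℚ-cong = sum-cong-≗ ℚ.+-0-commutativeMonoid

∏-one : ∀ n → ∏ℚ {n} (λ _ → 1ℚ) ≡ 1ℚ
∏-one = sum-replicate-zero ℚ.*-1-commutativeMonoid

^-nonneg : ∀ {s} n → 0ℚ ℚ.≤ s → 0ℚ ℚ.≤ s ^ n
^-nonneg zero    0≤s = 0≤1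
^-nonneg (suc n) 0≤s = *-nonneg 0≤s (^-nonneg n 0≤s)

^-monoˡ-≤ : ∀ {s t} n → 0ℚ ℚ.≤ s → s ℚ.≤ t → s ^ n ℚ.≤ t ^ n
^-monoˡ-≤ zero    0≤s s≤t = ℚ.≤-refl
^-monoˡ-≤ (suc n) 0≤s s≤t = *-mono-≤ 0≤s s≤t (^-nonneg n 0≤s) (^-monoˡ-≤ n 0≤s s≤t)

·-nonneg : ∀ {x} n → 0ℚ ℚ.≤ x → 0ℚ ℚ.≤ n · x
·-nonneg zero    0≤x = ℚ.≤-refl
·-nonneg (suc n) 0≤x = ℚ.+-mono-≤ 0≤x (·-nonneg n 0≤x)

-- Truncated exponential series

+-/-same : ∀ m n d .{{_ : ℕ.NonZero d}} → (+ m ℚ./ d) ℚ.+ (+ n ℚ./ d) ≡ + (m ℕ.+ n) ℚ./ d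
+-/-same m n (suc d) = ℚ.toℚᵘ-injective (begin
  ℚ.toℚᵘ ((+ m ℚ./ suc d) ℚ.+ (+ n ℚ./ suc d))
    ≈⟨ ℚ.toℚᵘ-homo-+ (+ m ℚ./ suc d) (+ n ℚ./ suc d) ⟩
  ℚ.toℚᵘ (+ m ℚ./ suc d) ℚᵘ.+ ℚ.toℚᵘ (+ n ℚ./ suc d)
    ≈⟨ ℚᵘ.+-cong (ℚ.toℚᵘ-fromℚᵘ (ℚᵘ.mkℚᵘ (+ m) d)) (ℚ.toℚᵘ-fromℚᵘ (ℚᵘ.mkℚᵘ (+ n) d)) ⟩
  ℚᵘ.mkℚᵘ (+ m) d ℚᵘ.+ ℚᵘ.mkℚᵘ (+ n) d
    ≈⟨ ℚᵘ.*≡* (trans (cong (ℤ._* + suc d) (sym (ℤ.*-distribʳ-+ (+ suc d) (+ m) (+ n))))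
                     (ℤ.*-assoc (+ m ℤ.+ + n) (+ suc d) (+ suc d))) ⟩
  ℚᵘ.mkℚᵘ (+ (m ℕ.+ n)) d
    ≈⟨ ℚ.toℚᵘ-fromℚᵘ (ℚᵘ.mkℚᵘ (+ (m ℕ.+ n)) d) ⟨
  ℚ.toℚᵘ (+ (m ℕ.+ n) ℚ./ suc d) ∎)
  where open import Relation.Binary.Reasoning.Setoid ℚᵘ.≃-setoid

·-1/ : ∀ n d .{{_ : ℕ.NonZero d}} → n · (+ 1 ℚ./ d) ≡ + n ℚ./ d
·-1/ zero    (suc d) = sym (ℚ.0/n≡0 (suc d))
·-1/ (suc n) d = trans (cong (+ 1 ℚ./ d ℚ.+_) (·-1/ n d)) (+-/-same 1 n d)

/-cancelˡ : ∀ k n d .{{_ : ℕ.NonZero d}} .{{_ : ℕ.NonZero (suc k ℕ.* d)}} →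
            + (suc k ℕ.* n) ℚ./ (suc k ℕ.* d) ≡ + n ℚ./ d
/-cancelˡ k n (suc d) = ℚ.fromℚᵘ-cong {ℚᵘ.mkℚᵘ (+ (suc k ℕ.* n)) _} {ℚᵘ.mkℚᵘ (+ n) d}
  (ℚᵘ.*≡* (begin
    + (suc k ℕ.* n) ℤ.* + suc d      ≡⟨ ℤ.pos-* (suc k ℕ.* n) (suc d) ⟨
    + (suc k ℕ.* n ℕ.* suc d)        ≡⟨ cong +_ (trans (cong (ℕ._* suc d) (ℕ.*-comm (suc k) n)) (ℕ.*-assoc n (suc k) (suc d))) ⟩
    + (n ℕ.* (suc k ℕ.* suc d))      ≡⟨ ℤ.pos-* n (suc k ℕ.* suc d) ⟩
    + n ℤ.* + (suc k ℕ.* suc d)      ∎))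
  where open ≡-Reasoning

1/!-suc : ∀ k → suc k · 1/ suc k ! ≡ 1/ k !
1/!-suc k = trans (·-1/ (suc k) (suc k !) {{suc k ℕ.!≢0}})
  (trans (cong (λ z → (+ z ℚ./ suc k !) {{suc k ℕ.!≢0}}) (sym (ℕ.*-identityʳ (suc k))))
    (/-cancelˡ k 1 (k !) {{k ℕ.!≢0}} {{suc k ℕ.!≢0}}))

1/!-nonneg : ∀ k → 0ℚ ℚ.≤ 1/ k !
1/!-nonneg k = ℚ.<⇒≤ (ℚ.positive⁻¹ (1/ k !) {{ℚ.normalize-pos 1 (k !) {{k ℕ.!≢0}}}})

-- These are the first two terms of the binomial expansion, and the remaining ones are nonnegative.
-- The homogeneous form avoids dividing by `s`, which may be 0.
bernoulli-≤ : ∀ {s x} n → 0ℚ ℚ.≤ s → 0ℚ ℚ.≤ x →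
  s ^ suc n ℚ.+ (suc n · x) ℚ.* s ^ n ℚ.≤ (s ℚ.+ x) ^ suc n
bernoulli-≤ {s} {x} zero 0≤s 0≤x = ℚ.≤-reflexive
  (solve 2 (λ s x → s :* con 1ℚ :+ (x :+ con 0ℚ) :* con 1ℚ := (s :+ x) :* con 1ℚ) refl s x)
  where open +-*-Solver
bernoulli-≤ {s} {x} (suc n) 0≤s 0≤x = begin
  s ℚ.* (s ℚ.* p) ℚ.+ (x ℚ.+ c) ℚ.* (s ℚ.* p)
    ≤⟨ ≤-+-nonneg (*-nonneg (*-nonneg 0≤x (·-nonneg (suc n) 0≤x)) (^-nonneg n 0≤s)) ⟩
  s ℚ.* (s ℚ.* p) ℚ.+ (x ℚ.+ c) ℚ.* (s ℚ.* p) ℚ.+ x ℚ.* c ℚ.* p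
    ≡⟨ solve 4 (λ s x p c → s :* (s :* p) :+ (x :+ c) :* (s :* p) :+ x :* c :* p
                            := (s :+ x) :* (s :* p :+ c :* p)) refl s x p c ⟩
  (s ℚ.+ x) ℚ.* (s ℚ.* p ℚ.+ c ℚ.* p)
    ≤⟨ ℚ.*-monoˡ-≤-nonNeg (s ℚ.+ x) {{ℚ.nonNegative (ℚ.+-mono-≤ 0≤s 0≤x)}} (bernoulli-≤ n 0≤s 0≤x) ⟩
  (s ℚ.+ x) ℚ.* (s ℚ.+ x) ^ suc n ∎
  where
  open ℚ.≤-Reasoning
  open +-*-Solver
  p = s ^ n
  c = suc n · x

exp-partial : ℕ → ℚ → ℚ
exp-partial zero    s = 1ℚ
exp-partial (suc k) s = exp-partial k s ℚ.+ 1/ suc k ! ℚ.* s ^ suc k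

-- By `1/!-suc` the left side is `1/ suc k !` times the two leading binomial terms of `bernoulli-≤`.
exp-term-shift : ∀ {s x} k → 0ℚ ℚ.≤ s → 0ℚ ℚ.≤ x →
  1/ suc k ! ℚ.* s ^ suc k ℚ.+ x ℚ.* (1/ k ! ℚ.* s ^ k)
    ℚ.≤ 1/ suc k ! ℚ.* (s ℚ.+ x) ^ suc k
exp-term-shift {s} {x} k 0≤s 0≤x = begin
  c ℚ.* s ^ suc k ℚ.+ x ℚ.* (1/ k ! ℚ.* s ^ k)
    ≡⟨ cong (λ z → c ℚ.* s ^ suc k ℚ.+ x ℚ.* (z ℚ.* s ^ k)) (1/!-suc k) ⟨
  c ℚ.* s ^ suc k ℚ.+ x ℚ.* ((suc k · c) ℚ.* s ^ k)
    ≡⟨ cong (c ℚ.* s ^ suc k ℚ.+_) (trans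
         (solve 3 (λ x d p → x :* (d :* p) := (d :* x) :* p) refl x (suc k · c) (s ^ k))
         (cong (ℚ._* s ^ k) (trans (×-assoc-* (suc k) c x)
           (trans (cong (suc k ·_) (ℚ.*-comm c x)) (sym (×-assoc-* (suc k) x c)))))) ⟩
  c ℚ.* s ^ suc k ℚ.+ ((suc k · x) ℚ.* c) ℚ.* s ^ k
    ≡⟨ solve 4 (λ c u d p → c :* u :+ (d :* c) :* p := c :* (u :+ d :* p)) refl c (s ^ suc k) (suc k · x) (s ^ k) ⟩
  c ℚ.* (s ^ suc k ℚ.+ (suc k · x) ℚ.* s ^ k)
    ≤⟨ ℚ.*-monoˡ-≤-nonNeg c {{ℚ.nonNegative (1/!-nonneg (suc k))}} (bernoulli-≤ k 0≤s 0≤x) ⟩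
  c ℚ.* (s ℚ.+ x) ^ suc k ∎
  where
  open ℚ.≤-Reasoning
  open +-*-Solver
  c = 1/ suc k !

-- A truncated form of `(1 + x) exp s ≤ exp (s + x)`. Multiplication by `x` raises the degree by
-- one, hence the two different truncations on the left: each term of degree `k` times `x` is
-- absorbed together with the term of degree `suc k`.
exp-shift : ∀ {s x} k → 0ℚ ℚ.≤ s → 0ℚ ℚ.≤ x →
  exp-partial (suc k) s ℚ.+ x ℚ.* exp-partial k s ℚ.≤ exp-partial (suc k) (s ℚ.+ x)
exp-shift {s} {x} zero 0≤s 0≤x = subst (ℚ._≤ exp-partial 1 (s ℚ.+ x))
  (sym (ℚ.+-assoc 1ℚ (1/ 1 ! ℚ.* s ^ 1) (x ℚ.* 1ℚ)))
  (ℚ.+-monoʳ-≤ 1ℚ (exp-term-shift 0 0≤s 0≤x))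
exp-shift {s} {x} (suc k) 0≤s 0≤x = begin
  (E₁ ℚ.+ t₁) ℚ.+ x ℚ.* (E₀ ℚ.+ t₀)
    ≡⟨ solve 5 (λ E₁ t₁ x E₀ t₀ → (E₁ :+ t₁) :+ x :* (E₀ :+ t₀)
                  := (E₁ :+ x :* E₀) :+ (t₁ :+ x :* t₀)) refl E₁ t₁ x E₀ t₀ ⟩
  (E₁ ℚ.+ x ℚ.* E₀) ℚ.+ (t₁ ℚ.+ x ℚ.* t₀)
    ≤⟨ ℚ.+-mono-≤ (exp-shift k 0≤s 0≤x) (exp-term-shift (suc k) 0≤s 0≤x) ⟩
  exp-partial (suc (suc k)) (s ℚ.+ x) ∎
  where
  open ℚ.≤-Reasoning
  open +-*-Solver
  E₁ = exp-partial (suc k) s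
  E₀ = exp-partial k s
  t₁ = 1/ suc (suc k) ! ℚ.* s ^ suc (suc k)
  t₀ = 1/ suc k ! ℚ.* s ^ suc k

∑-nonneg : ∀ {n} (b : Vector ℚ n) → (∀ i → 0ℚ ℚ.≤ b i) → 0ℚ ℚ.≤ ∑ℚ b
∑-nonneg {zero}  b 0≤b = ℚ.≤-refl
∑-nonneg {suc n} b 0≤b = ℚ.+-mono-≤ (0≤b zero) (∑-nonneg (b ∘ suc) (0≤b ∘ suc))

-- Each new factor raises the degree by one, so `n` factors need the series only up to degree `n`.
∏-1+≤exp-∑ : ∀ {n} (b : Vector ℚ n) → (∀ i → 0ℚ ℚ.≤ b i) →
             ∏ℚ (λ i → 1ℚ ℚ.+ b i) ℚ.≤ exp-partial n (∑ℚ b)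
∏-1+≤exp-∑ {zero}  b 0≤b = ℚ.≤-refl
∏-1+≤exp-∑ {suc n} b 0≤b = begin
  (1ℚ ℚ.+ x) ℚ.* ∏ℚ (λ i → 1ℚ ℚ.+ b (suc i))
    ≤⟨ ℚ.*-monoˡ-≤-nonNeg (1ℚ ℚ.+ x) {{ℚ.nonNegative (ℚ.+-mono-≤ 0≤1 (0≤b zero))}}
         (∏-1+≤exp-∑ (b ∘ suc) (0≤b ∘ suc)) ⟩
  (1ℚ ℚ.+ x) ℚ.* E
    ≡⟨ trans (ℚ.*-distribʳ-+ E 1ℚ x) (cong (ℚ._+ x ℚ.* E) (ℚ.*-identityˡ E)) ⟩
  E ℚ.+ x ℚ.* E
    -- The first copy of `E` gains its term of degree `suc n`, to match the degrees in `exp-shift`.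
    ≤⟨ ℚ.+-monoˡ-≤ (x ℚ.* E) (≤-+-nonneg {E} (*-nonneg (1/!-nonneg (suc n)) (^-nonneg (suc n) 0≤s))) ⟩
  exp-partial (suc n) s ℚ.+ x ℚ.* E
    ≤⟨ exp-shift n 0≤s (0≤b zero) ⟩
  exp-partial (suc n) (s ℚ.+ x)
    ≡⟨ cong (exp-partial (suc n)) (ℚ.+-comm s x) ⟩
  exp-partial (suc n) (x ℚ.+ s) ∎
  where
  open ℚ.≤-Reasoning
  x = b zero
  s = ∑ℚ (b ∘ suc)
  E = exp-partial n s
  0≤s = ∑-nonneg (b ∘ suc) (0≤b ∘ suc)

exp-partial-mono-≤ : ∀ {s t} k → 0ℚ ℚ.≤ s → s ℚ.≤ t → exp-partial k s ℚ.≤ exp-partial k t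
exp-partial-mono-≤ zero    0≤s s≤t = ℚ.≤-refl
exp-partial-mono-≤ (suc k) 0≤s s≤t = ℚ.+-mono-≤ (exp-partial-mono-≤ k 0≤s s≤t)
  (ℚ.*-monoˡ-≤-nonNeg (1/ suc k !) {{ℚ.nonNegative (1/!-nonneg (suc k))}} (^-monoˡ-≤ (suc k) 0≤s s≤t))

e-partial-nonneg : ∀ n → 0ℚ ℚ.≤ e-partial n
e-partial-nonneg n = ℚ.≤-trans 0≤1 (1≤e-partial n)

-- For `1 ≤ t` every power occurring in the series is at most the top power `t ^ k`, which can be
-- factored out. This takes the place of continuity of exp at 1.
exp-partial≤^*e-partial : ∀ {t} k → 1ℚ ℚ.≤ t → exp-partial k t ℚ.≤ t ^ k ℚ.* e-partial k
exp-partial≤^*e-partial zero    1≤t = ℚ.≤-refl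
exp-partial≤^*e-partial {t} (suc k) 1≤t = begin
  exp-partial k t ℚ.+ c ℚ.* t ^ suc k
    ≤⟨ ℚ.+-monoˡ-≤ (c ℚ.* t ^ suc k) (exp-partial≤^*e-partial k 1≤t) ⟩
  t ^ k ℚ.* E ℚ.+ c ℚ.* t ^ suc k
    ≤⟨ ℚ.+-monoˡ-≤ (c ℚ.* t ^ suc k) (ℚ.*-monoʳ-≤-nonNeg E {{ℚ.nonNegative (e-partial-nonneg k)}}
         (subst (ℚ._≤ t ^ suc k) (ℚ.*-identityˡ (t ^ k))
           (ℚ.*-monoʳ-≤-nonNeg (t ^ k) {{ℚ.nonNegative (^-nonneg k (ℚ.≤-trans 0≤1 1≤t))}} 1≤t))) ⟩
  t ^ suc k ℚ.* E ℚ.+ c ℚ.* t ^ suc k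
    ≡⟨ solve 3 (λ c u E → u :* E :+ c :* u := u :* (E :+ c)) refl c (t ^ suc k) E ⟩
  t ^ suc k ℚ.* e-partial (suc k) ∎
  where
  open ℚ.≤-Reasoning
  open +-*-Solver
  c = 1/ suc k !
  E = e-partial k

e-partial-mono : ∀ {m n} → m ℕ.≤ n → e-partial m ℚ.≤ e-partial n
e-partial-mono {m} {n} m≤n = go (ℕ.≤⇒≤′ m≤n)
  where
  go : ∀ {n} → m ℕ.≤′ n → e-partial m ℚ.≤ e-partial n
  go (ℕ.≤′-reflexive refl) = ℚ.≤-refl
  go {suc n} (ℕ.≤′-step m≤n) = ℚ.≤-trans (go m≤n) (≤-+-nonneg (1/!-nonneg (suc n)))

-- Going from `n` to `suc n` loses exactly `δ (δ + n · δ) (1 + δ) ^ n`, which is nonnegative.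
-- Written without division, the bound asks nothing of the sign of `1 - n · δ`.
^-reciprocal-bound : ∀ {δ} n → 0ℚ ℚ.≤ δ → (1ℚ ℚ.+ δ) ^ n ℚ.* (1ℚ ℚ.- n · δ) ℚ.≤ 1ℚ
^-reciprocal-bound zero    0≤δ = ℚ.≤-refl
^-reciprocal-bound {δ} (suc n) 0≤δ = begin
  ((1ℚ ℚ.+ δ) ℚ.* p) ℚ.* (1ℚ ℚ.- (δ ℚ.+ c))
    ≤⟨ ≤-+-nonneg (*-nonneg (*-nonneg 0≤δ (ℚ.+-mono-≤ 0≤δ (·-nonneg n 0≤δ)))
                            (^-nonneg n (ℚ.+-mono-≤ 0≤1 0≤δ))) ⟩
  ((1ℚ ℚ.+ δ) ℚ.* p) ℚ.* (1ℚ ℚ.- (δ ℚ.+ c)) ℚ.+ δ ℚ.* (δ ℚ.+ c) ℚ.* p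
    ≡⟨ solve 3 (λ δ p c → ((con 1ℚ :+ δ) :* p) :* (con 1ℚ :- (δ :+ c)) :+ δ :* (δ :+ c) :* p
                          := p :* (con 1ℚ :- c)) refl δ p c ⟩
  p ℚ.* (1ℚ ℚ.- c)
    ≤⟨ ^-reciprocal-bound n 0≤δ ⟩
  1ℚ ∎
  where
  open ℚ.≤-Reasoning
  open +-*-Solver
  p = (1ℚ ℚ.+ δ) ^ n
  c = n · δ

-- The attenuation function

_⁺ : ℚ → ℚ
a ⁺ = 0ℚ ℚ.⊔ a

0≤⁺ : ∀ a → 0ℚ ℚ.≤ a ⁺
0≤⁺ = ℚ.p≤p⊔q 0ℚ

0<1+⁺ : ∀ a → 0ℚ ℚ.< 1ℚ ℚ.+ a ⁺
0<1+⁺ a = ℚ.+-mono-<-≤ (ℚ.positive⁻¹ 1ℚ) (0≤⁺ a)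

-- The positive part makes 1/(1 + x) total; it leaves a nonnegative real unchanged up to _≃_.
attenuate : ℚ → ℚ
attenuate a = (ℚ.1/ (1ℚ ℚ.+ a ⁺)) {{ℚ.>-nonZero (0<1+⁺ a)}}

attenuate-inverse : ∀ a → attenuate a ℚ.* (1ℚ ℚ.+ a ⁺) ≡ 1ℚ
attenuate-inverse a = ℚ.*-inverseˡ (1ℚ ℚ.+ a ⁺) {{ℚ.>-nonZero (0<1+⁺ a)}}

0≤attenuate : ∀ a → 0ℚ ℚ.≤ attenuate a
0≤attenuate a = ℚ.<⇒≤ (ℚ.positive⁻¹ (attenuate a)
  {{ℚ.1/pos⇒pos (1ℚ ℚ.+ a ⁺) {{ℚ.positive (0<1+⁺ a)}}}})

reciprocal≤1 : ∀ {r p} → 0ℚ ℚ.≤ r → 1ℚ ℚ.≤ p → r ℚ.* p ≡ 1ℚ → r ℚ.≤ 1ℚ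
reciprocal≤1 {r} {p} 0≤r 1≤p eq = subst₂ ℚ._≤_ (ℚ.*-identityʳ r) eq
  (ℚ.*-monoˡ-≤-nonNeg r {{ℚ.nonNegative 0≤r}} 1≤p)

attenuate≤1 : ∀ a → attenuate a ℚ.≤ 1ℚ
attenuate≤1 a = reciprocal≤1 (0≤attenuate a) (≤-+-nonneg (0≤⁺ a)) (attenuate-inverse a)

≤∣∣ : ∀ p → p ℚ.≤ ℚ.∣ p ∣
≤∣∣ p with ℚ.≤-total 0ℚ p
... | inj₁ 0≤p = ℚ.≤-reflexive (sym (ℚ.0≤p⇒∣p∣≡p 0≤p))
... | inj₂ p≤0 = ℚ.≤-trans p≤0 (ℚ.0≤∣p∣ p)

∣-∣-lub : ∀ {p q} → p ℚ.≤ q → ℚ.- p ℚ.≤ q → ℚ.∣ p ∣ ℚ.≤ q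
∣-∣-lub {p} p≤q -p≤q with ℚ.∣p∣≡p∨∣p∣≡-p p
... | inj₁ eq = ℚ.≤-trans (ℚ.≤-reflexive eq) p≤q
... | inj₂ eq = ℚ.≤-trans (ℚ.≤-reflexive eq) -p≤q

neg-sub : ∀ a b → ℚ.- (a ℚ.- b) ≡ b ℚ.- a
neg-sub = solve 2 (λ a b → :- (a :- b) := b :- a) refl
  where open +-*-Solver

∣-∣-sub-comm : ∀ a b → ℚ.∣ a ℚ.- b ∣ ≡ ℚ.∣ b ℚ.- a ∣
∣-∣-sub-comm a b = trans (sym (ℚ.∣-p∣≡∣p∣ (a ℚ.- b))) (cong ℚ.∣_∣ (neg-sub a b))

-- Applied index by index, such a function keeps the modulus of a Cauchy sequence and respects
-- `_≃_`.
1-Lipschitz : (ℚ → ℚ) → Set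
1-Lipschitz f = ∀ a b → ℚ.∣ f a ℚ.- f b ∣ ℚ.≤ ℚ.∣ a ℚ.- b ∣

one-sided⇒1-Lipschitz : ∀ f → (∀ a b → f a ℚ.- f b ℚ.≤ ℚ.∣ a ℚ.- b ∣) → 1-Lipschitz f
one-sided⇒1-Lipschitz f h a b = ∣-∣-lub (h a b)
  (subst₂ ℚ._≤_ (sym (neg-sub (f a) (f b))) (∣-∣-sub-comm b a) (h b a))

⁺-1-Lipschitz : 1-Lipschitz _⁺
⁺-1-Lipschitz = one-sided⇒1-Lipschitz _⁺ λ a b → begin
  a ⁺ ℚ.- b ⁺
    ≤⟨ ℚ.+-monoˡ-≤ (ℚ.- b ⁺) (ℚ.⊔-lub (ℚ.+-mono-≤ (0≤⁺ b) (ℚ.0≤∣p∣ (a ℚ.- b)))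
         (subst (ℚ._≤ b ⁺ ℚ.+ ℚ.∣ a ℚ.- b ∣) (solve 2 (λ a b → b :+ (a :- b) := a) refl a b)
           (ℚ.+-mono-≤ (ℚ.p≤q⊔p 0ℚ b) (≤∣∣ (a ℚ.- b))))) ⟩
  (b ⁺ ℚ.+ ℚ.∣ a ℚ.- b ∣) ℚ.- b ⁺
    ≡⟨ solve 2 (λ b d → (b :+ d) :- b := d) refl (b ⁺) (ℚ.∣ a ℚ.- b ∣) ⟩
  ℚ.∣ a ℚ.- b ∣ ∎
  where
  open ℚ.≤-Reasoning
  open +-*-Solver

∣-∣-*-mono : ∀ p q {a b} → ℚ.∣ p ∣ ℚ.≤ a → ℚ.∣ q ∣ ℚ.≤ b → ℚ.∣ p ℚ.* q ∣ ℚ.≤ a ℚ.* b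
∣-∣-*-mono p q p≤a q≤b = ℚ.≤-trans (ℚ.≤-reflexive (ℚ.∣p*q∣≡∣p∣*∣q∣ p q))
  (*-mono-≤ (ℚ.0≤∣p∣ p) p≤a (ℚ.0≤∣p∣ q) q≤b)

0≤p≤1⇒∣p∣≤1 : ∀ {p} → 0ℚ ℚ.≤ p → p ℚ.≤ 1ℚ → ℚ.∣ p ∣ ℚ.≤ 1ℚ
0≤p≤1⇒∣p∣≤1 0≤p p≤1 = ℚ.≤-trans (ℚ.≤-reflexive (ℚ.0≤p⇒∣p∣≡p 0≤p)) p≤1

attenuate-1-Lipschitz : 1-Lipschitz attenuate
attenuate-1-Lipschitz a b = begin
  ℚ.∣ u ℚ.- v ∣
    -- Expanding each reciprocal by the other one's inverse equation lets `u v` factor out, and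
    -- `u v` lies in the unit interval.
    ≡⟨ cong ℚ.∣_∣ (trans (cong₂ ℚ._-_ (sym (ℚ.*-identityʳ u)) (sym (ℚ.*-identityʳ v)))
         (cong₂ (λ x y → u ℚ.* x ℚ.- v ℚ.* y) (sym (attenuate-inverse b)) (sym (attenuate-inverse a)))) ⟩
  ℚ.∣ u ℚ.* (v ℚ.* (1ℚ ℚ.+ b ⁺)) ℚ.- v ℚ.* (u ℚ.* (1ℚ ℚ.+ a ⁺)) ∣
    ≡⟨ cong ℚ.∣_∣ (solve 4 (λ u v a b → u :* (v :* (con 1ℚ :+ b)) :- v :* (u :* (con 1ℚ :+ a))
         := (u :* v) :* (b :- a)) refl u v (a ⁺) (b ⁺)) ⟩
  ℚ.∣ (u ℚ.* v) ℚ.* (b ⁺ ℚ.- a ⁺) ∣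
    ≤⟨ ∣-∣-*-mono (u ℚ.* v) (b ⁺ ℚ.- a ⁺) (∣-∣-*-mono u v
         (0≤p≤1⇒∣p∣≤1 (0≤attenuate a) (attenuate≤1 a)) (0≤p≤1⇒∣p∣≤1 (0≤attenuate b) (attenuate≤1 b)))
         (⁺-1-Lipschitz b a) ⟩
  (1ℚ ℚ.* 1ℚ) ℚ.* ℚ.∣ b ℚ.- a ∣
    ≡⟨ trans (ℚ.*-identityˡ ℚ.∣ b ℚ.- a ∣) (∣-∣-sub-comm b a) ⟩
  ℚ.∣ a ℚ.- b ∣ ∎
  where
  open ℚ.≤-Reasoning
  open +-*-Solver
  u = attenuate a
  v = attenuate b

-- Comparison with 1/e at a single index.

∏-attenuate-inverse : ∀ {n} (a : Vector ℚ n) →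
  ∏ℚ (λ i → attenuate (a i)) ℚ.* ∏ℚ (λ i → 1ℚ ℚ.+ a i ⁺) ≡ 1ℚ
∏-attenuate-inverse {n} a = trans (sym (∏-distrib-* (λ i → attenuate (a i)) (λ i → 1ℚ ℚ.+ a i ⁺)))
  (trans (∏-cong (λ i → attenuate-inverse (a i))) (∏-one n))

-- Since `Q W = 1` and `r E = 1`, the bound `W ≤ t ^ n E` turns into `r ≤ t ^ n Q`. Multiplying by
-- `d = 1 - n · δ` removes `t ^ n`, and the part `r (n · δ)` left over is at most `n · δ` because
-- `r ≤ 1`. The hypothesis `n ≤ m` puts all terms up to degree `n` into `e-partial m`.
1/e≤∏-attenuate : ∀ {n m δ} (a : Vector ℚ n) → n ℕ.≤ m → 0ℚ ℚ.≤ δ →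
  ∑ℚ (λ i → a i ⁺) ℚ.≤ 1ℚ ℚ.+ δ →
  seq 1/e m ℚ.≤ ∏ℚ (λ i → attenuate (a i)) ℚ.+ n · δ
1/e≤∏-attenuate {n} {m} {δ} a n≤m 0≤δ ∑≤ = begin
  r
    ≡⟨ solve 2 (λ r d → r := r :* (con 1ℚ :- d) :+ r :* d) refl r (n · δ) ⟩
  r ℚ.* d ℚ.+ r ℚ.* (n · δ)
    ≤⟨ ℚ.+-mono-≤ r*d≤Q (ℚ.*-monoʳ-≤-nonNeg (n · δ) {{ℚ.nonNegative (·-nonneg n 0≤δ)}} r≤1) ⟩
  Q ℚ.+ 1ℚ ℚ.* (n · δ)
    ≡⟨ cong (Q ℚ.+_) (ℚ.*-identityˡ (n · δ)) ⟩
  Q ℚ.+ n · δ ∎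
  where
  open ℚ.≤-Reasoning
  open +-*-Solver
  r = seq 1/e m
  E = e-partial m
  t = 1ℚ ℚ.+ δ
  d = 1ℚ ℚ.- n · δ
  Q = ∏ℚ λ i → attenuate (a i)
  W = ∏ℚ λ i → 1ℚ ℚ.+ a i ⁺

  r*E≡1 : r ℚ.* E ≡ 1ℚ
  r*E≡1 = ℚ.*-inverseˡ E {{e-partial-nonZero m}}

  0≤r : 0ℚ ℚ.≤ r
  0≤r = ℚ.<⇒≤ (ℚ.positive⁻¹ r {{ℚ.1/pos⇒pos E {{ℚ.positive
    (ℚ.<-≤-trans (ℚ.positive⁻¹ 1ℚ) (1≤e-partial m))}}}})

  r≤1 : r ℚ.≤ 1ℚ
  r≤1 = reciprocal≤1 0≤r (1≤e-partial m) r*E≡1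

  0≤Q : 0ℚ ℚ.≤ Q
  0≤Q = ∏-nonneg (λ i → attenuate (a i)) (λ i → 0≤attenuate (a i))

  0≤t : 0ℚ ℚ.≤ t
  0≤t = ℚ.+-mono-≤ 0≤1 0≤δ

  W≤ : W ℚ.≤ t ^ n ℚ.* E
  W≤ = begin
    W
      ≤⟨ ∏-1+≤exp-∑ (λ i → a i ⁺) (λ i → 0≤⁺ (a i)) ⟩
    exp-partial n (∑ℚ λ i → a i ⁺)
      ≤⟨ exp-partial-mono-≤ n (∑-nonneg (λ i → a i ⁺) (λ i → 0≤⁺ (a i))) ∑≤ ⟩
    exp-partial n t
      ≤⟨ exp-partial≤^*e-partial n (≤-+-nonneg 0≤δ) ⟩
    t ^ n ℚ.* e-partial n
      ≤⟨ ℚ.*-monoˡ-≤-nonNeg (t ^ n) {{ℚ.nonNegative (^-nonneg n 0≤t)}} (e-partial-mono n≤m) ⟩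
    t ^ n ℚ.* E ∎

  r*d≤Q : r ℚ.* d ℚ.≤ Q
  r*d≤Q with ℚ.≤-total 0ℚ d
  -- The bound on `W` may only be multiplied by `r * d` when `d` is nonnegative; otherwise the left
  -- side is at most 0 and `0 ≤ Q` suffices.
  ... | inj₂ d≤0 = ℚ.≤-trans (subst (r ℚ.* d ℚ.≤_) (ℚ.*-zeroʳ r)
                     (ℚ.*-monoˡ-≤-nonNeg r {{ℚ.nonNegative 0≤r}} d≤0)) 0≤Q
  ... | inj₁ 0≤d = begin
    r ℚ.* d
      ≡⟨ ℚ.*-identityʳ (r ℚ.* d) ⟨
    (r ℚ.* d) ℚ.* 1ℚ
      ≡⟨ cong ((r ℚ.* d) ℚ.*_) (∏-attenuate-inverse a) ⟨
    (r ℚ.* d) ℚ.* (Q ℚ.* W)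
      ≤⟨ ℚ.*-monoˡ-≤-nonNeg (r ℚ.* d) {{ℚ.nonNegative (*-nonneg 0≤r 0≤d)}}
           (ℚ.*-monoˡ-≤-nonNeg Q {{ℚ.nonNegative 0≤Q}} W≤) ⟩
    (r ℚ.* d) ℚ.* (Q ℚ.* (t ^ n ℚ.* E))
      ≡⟨ solve 5 (λ r d Q p E → (r :* d) :* (Q :* (p :* E)) := (r :* E) :* (Q :* (p :* d)))
           refl r d Q (t ^ n) E ⟩
    (r ℚ.* E) ℚ.* (Q ℚ.* (t ^ n ℚ.* d))
      ≡⟨ trans (cong (ℚ._* (Q ℚ.* (t ^ n ℚ.* d))) r*E≡1) (ℚ.*-identityˡ (Q ℚ.* (t ^ n ℚ.* d))) ⟩
    Q ℚ.* (t ^ n ℚ.* d)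
      ≤⟨ ℚ.*-monoˡ-≤-nonNeg Q {{ℚ.nonNegative 0≤Q}} (^-reciprocal-bound n 0≤δ) ⟩
    Q ℚ.* 1ℚ
      ≡⟨ ℚ.*-identityʳ Q ⟩
    Q ∎

-- Sums over subsets

bernoulli : ℚ → Bool → ℚ
bernoulli a b = if b then a else 1ℚ ℚ.- a

⟦_⟧ : Bool → ℚ
⟦ b ⟧ = if b then 1ℚ else 0ℚ

∑ℚSubset : ∀ {n} → (Subset n → ℚ) → ℚ
∑ℚSubset {zero}  f = f []
∑ℚSubset {suc n} f = ∑ℚSubset (λ S → f (outside ∷ S)) ℚ.+ ∑ℚSubset (λ S → f (inside ∷ S))

∑ℚSubset-cong : ∀ {n} {f g : Subset n → ℚ} → (∀ S → f S ≡ g S) → ∑ℚSubset f ≡ ∑ℚSubset g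
∑ℚSubset-cong {zero}  f≡g = f≡g []
∑ℚSubset-cong {suc n} f≡g = cong₂ ℚ._+_
  (∑ℚSubset-cong (λ S → f≡g (outside ∷ S))) (∑ℚSubset-cong (λ S → f≡g (inside ∷ S)))

*-distribˡ-∑ℚSubset : ∀ {n} c (f : Subset n → ℚ) → ∑ℚSubset (λ S → c ℚ.* f S) ≡ c ℚ.* ∑ℚSubset f
*-distribˡ-∑ℚSubset {zero}  c f = refl
*-distribˡ-∑ℚSubset {suc n} c f = trans
  (cong₂ ℚ._+_ (*-distribˡ-∑ℚSubset c (λ S → f (outside ∷ S)))
               (*-distribˡ-∑ℚSubset c (λ S → f (inside ∷ S))))
  (sym (ℚ.*-distribˡ-+ c _ _))

-- The distributive law: expanding a product of `n` binomials gives one summand for each subset.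
-- This is where independence enters. As a polynomial identity it also covers weights outside the
-- unit interval.
∑ℚSubset-∏ : ∀ {n} (h : Fin n → Bool → ℚ) →
  ∑ℚSubset (λ S → ∏ℚ λ j → h j (lookup S j)) ≡ ∏ℚ λ j → h j outside ℚ.+ h j inside
∑ℚSubset-∏ {zero}  h = refl
∑ℚSubset-∏ {suc n} h = begin
  ∑ℚSubset (λ S → h zero outside ℚ.* p S) ℚ.+ ∑ℚSubset (λ S → h zero inside ℚ.* p S)
    ≡⟨ cong₂ ℚ._+_ (*-distribˡ-∑ℚSubset (h zero outside) p) (*-distribˡ-∑ℚSubset (h zero inside) p) ⟩
  h zero outside ℚ.* ∑ℚSubset p ℚ.+ h zero inside ℚ.* ∑ℚSubset p
    ≡⟨ ℚ.*-distribʳ-+ (∑ℚSubset p) (h zero outside) (h zero inside) ⟨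
  (h zero outside ℚ.+ h zero inside) ℚ.* ∑ℚSubset p
    ≡⟨ cong ((h zero outside ℚ.+ h zero inside) ℚ.*_) (∑ℚSubset-∏ (h ∘ suc)) ⟩
  (h zero outside ℚ.+ h zero inside) ℚ.* ∏ℚ (λ j → h (suc j) outside ℚ.+ h (suc j) inside) ∎
  where
  open ≡-Reasoning
  p : Subset _ → ℚ
  p S = ∏ℚ λ j → h (suc j) (lookup S j)

-- Real expressions evaluated at one index, and an enumeration of all subsets.

seq-if : ∀ b (x y : ℝ) m → seq (if b then x else y) m ≡ (if b then seq x m else seq y m)
seq-if true  x y m = refl
seq-if false x y m = refl

seq-∑ : ∀ {n} (f : Vector ℝ n) m → seq (∑ f) m ≡ ∑ℚ (λ i → seq (f i) m)
seq-∑ {zero}  f m = refl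
seq-∑ {suc n} f m = cong (seq (f zero) m ℚ.+_) (seq-∑ (f ∘ suc) m)

seq-∏ : ∀ {n} (f : Vector ℝ n) m → seq (∏ f) m ≡ ∏ℚ (λ i → seq (f i) m)
seq-∏ {zero}  f m = refl
seq-∏ {suc n} f m = cong (seq (f zero) m ℚ.*_) (seq-∏ (f ∘ suc) m)

seq-∑Subset : ∀ {n} (f : Subset n → ℝ) m → seq (∑Subset f) m ≡ ∑ℚSubset (λ S → seq (f S) m)
seq-∑Subset {zero}  f m = refl
seq-∑Subset {suc n} f m = cong₂ ℚ._+_
  (seq-∑Subset (λ S → f (outside ∷ S)) m) (seq-∑Subset (λ S → f (inside ∷ S)) m)

seq-activeProb : ∀ {n} (x : Vector ℝ n) S m →
  seq (activeProb x S) m ≡ ∏ℚ λ j → bernoulli (seq (x j) m) (lookup S j)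
seq-activeProb x S m = trans (seq-∏ (λ j → if lookup S j then x j else 1ℝ - x j) m)
  (∏-cong λ j → seq-if (lookup S j) (x j) (1ℝ - x j) m)

∑ℚ-↑ : ∀ m n (f : Vector ℚ (m ℕ.+ n)) →
  ∑ℚ f ≡ ∑ℚ (λ i → f (i ↑ˡ n)) ℚ.+ ∑ℚ (λ i → f (m ↑ʳ i))
∑ℚ-↑ zero    n f = sym (ℚ.+-identityˡ (∑ℚ f))
∑ℚ-↑ (suc m) n f = trans (cong (f zero ℚ.+_) (∑ℚ-↑ m n (f ∘ suc)))
  (sym (ℚ.+-assoc (f zero) (∑ℚ λ i → f (suc (i ↑ˡ n))) (∑ℚ λ i → f (suc (m ↑ʳ i)))))

∑ℚ-++ : ∀ {A : Set} {m n} (f : A → ℚ) (xs : Vector A m) (ys : Vector A n) →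
  ∑ℚ (f ∘ (xs ++ ys)) ≡ ∑ℚ (f ∘ xs) ℚ.+ ∑ℚ (f ∘ ys)
∑ℚ-++ {m = m} {n} f xs ys = trans (∑ℚ-↑ m n (f ∘ (xs ++ ys)))
  (cong₂ ℚ._+_ (∑ℚ-cong (λ i → cong f (lookup-++ˡ xs ys i)))
               (∑ℚ-cong (λ i → cong f (lookup-++ʳ xs ys i))))

-- The recursion yields definitionally the length that `_++_` produces in `subsets`; a power of 2
-- would reduce to a sum with a trailing `+ 0`.
#subsets : ℕ → ℕ
#subsets zero    = 1
#subsets (suc n) = #subsets n ℕ.+ #subsets n

subsets : ∀ n → Vector (Subset n) (#subsets n)
subsets zero    = λ _ → []
subsets (suc n) = map (outside ∷_) (subsets n) ++ map (inside ∷_) (subsets n)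

∑ℚ-subsets : ∀ {n} (f : Subset n → ℚ) → ∑ℚ (f ∘ subsets n) ≡ ∑ℚSubset f
∑ℚ-subsets {zero}  f = ℚ.+-identityʳ (f [])
∑ℚ-subsets {suc n} f = trans
  (∑ℚ-++ f (map (outside ∷_) (subsets n)) (map (inside ∷_) (subsets n)))
  (cong₂ ℚ._+_ (∑ℚ-subsets (λ S → f (outside ∷ S))) (∑ℚ-subsets (λ S → f (inside ∷ S))))

-- As a product, the indicator merges coordinate by coordinate with the Bernoulli weights. The
-- decision is arbitrary, because the induction moves to a different one on the tail.
⟦⟧-∏ : ∀ {n} {P : Fin n → Bool} (∀P? : Dec (∀ j → T (P j))) → ⟦ does ∀P? ⟧ ≡ ∏ℚ λ j → ⟦ P j ⟧
⟦⟧-∏ {zero} (yes _) = refl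
⟦⟧-∏ {zero} (no ¬∀) = contradiction (λ ()) ¬∀
⟦⟧-∏ {suc n} {P} ∀P? with P zero in eq
... | false with ∀P?
...   | yes ∀P = contradiction (subst T eq (∀P zero)) λ ()
...   | no  _  = sym (ℚ.*-zeroˡ (∏ℚ λ j → ⟦ P (suc j) ⟧))
⟦⟧-∏ {suc n} {P} ∀P? | true = trans
  (trans (cong ⟦_⟧ (does-⇔ (mk⇔ (λ ∀P j → ∀P (suc j)) extend) ∀P? tail?)) (⟦⟧-∏ tail?))
  (sym (ℚ.*-identityˡ (∏ℚ λ j → ⟦ P (suc j) ⟧)))
  where
  extend : (∀ j → T (P (suc j))) → ∀ j → T (P j)
  extend ∀P zero    = subst T (sym eq) _
  extend ∀P (suc j) = ∀P j
  tail? : Dec (∀ j → T (P (suc j)))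
  tail? = all? (λ j → T? (P (suc j)))

-- The random family

singletonsIn : ∀ {n} → Subset n → GreedyFamily (SingleItem n)
singletonsIn {n} S = record
  { member     = λ U → ⌊ in? U ⌋
  ; feasible   = λ {U} U∈ → proj₁ (toWitness {a? = in? U} U∈)
  ; ∅∈         = fromWitness {a? = in? ⊥} (subst (ℕ._≤ 1) (sym (Subset.∣⊥∣≡0 n)) ℕ.z≤n , Subset.⊥⊆)
  ; downClosed = λ {U} {V} U∈ V⊆U → let ∣U∣≤1 , U⊆S = toWitness {a? = in? U} U∈ in
      fromWitness {a? = in? V} (ℕ.≤-trans (Subset.p⊆q⇒∣p∣≤∣q∣ V⊆U) ∣U∣≤1 , λ v → U⊆S (V⊆U v))
  }
  where
  in? : ∀ U → Dec (∣ U ∣ ℕ.≤ 1 × U ⊆ S)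
  in? U = (∣ U ∣ ℕ.≤? 1) ×-dec (U Subset.⊆? S)

∈-singletonsIn⁻ : ∀ {n} {S U : Subset n} → U ∈ᶠ singletonsIn S → ∣ U ∣ ℕ.≤ 1 × U ⊆ S
∈-singletonsIn⁻ {S = S} {U} = toWitness {a? = (∣ U ∣ ℕ.≤? 1) ×-dec (U Subset.⊆? S)}

∈-singletonsIn⁺ : ∀ {n} {S U : Subset n} → ∣ U ∣ ℕ.≤ 1 × U ⊆ S → U ∈ᶠ singletonsIn S
∈-singletonsIn⁺ {S = S} {U} = fromWitness {a? = (∣ U ∣ ℕ.≤? 1) ×-dec (U Subset.⊆? S)}

∣p∣≤1⇒x≡y : ∀ {n} {p : Subset n} {x y} → ∣ p ∣ ℕ.≤ 1 → x ∈ p → y ∈ p → x ≡ y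
∣p∣≤1⇒x≡y {p = p} {x} {y} ∣p∣≤1 x∈p y∈p with x ≟ y
... | yes x≡y = x≡y
... | no  x≢y = contradiction
  (ℕ.≤-trans (Subset.x∈p⇒∣p-x∣<∣p∣ (Subset.x∈p∧x≢y⇒x∈p-y x∈p x≢y))
    (ℕ.s≤s⁻¹ (ℕ.≤-trans (Subset.x∈p⇒∣p-x∣<∣p∣ y∈p) ∣p∣≤1))) λ ()

compatible : ∀ {n} → Fin n → Fin n → Bool → Bool → Bool
compatible i j r s = if does (j ≟ i) then s else not (r ∧ s)

-- Forwards, two kinds of test set suffice: `I = ⊥` forces `i` into `S`, and `I = ⁅ j ⁆` with `j` in
-- both `R` and `S` would make `⁅ j ⁆ ∪ ⁅ i ⁆` a member of size at most 1, so `j` would be `i`.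
-- Backwards, a member `I ⊆ R` lies in both `R` and `S`, hence inside `⁅ i ⁆`.
neverBlocked⇔ : ∀ {n} i (R S : Subset n) →
  NeverBlocked i R (singletonsIn S) ⇔ (∀ j → T (compatible i j (lookup R j) (lookup S j)))
neverBlocked⇔ {n} i R S = mk⇔ to from
  where
  to : NeverBlocked i R (singletonsIn S) → ∀ j → T (compatible i j (lookup R j) (lookup S j))
  to nb j with j ≟ i
  ... | yes refl = subst T (sym ([]=⇒lookup (proj₂ (∈-singletonsIn⁻ {S = S}
        (nb ⊥ Subset.⊥⊆ (GreedyFamily.∅∈ (singletonsIn S)))) (Subset.q⊆p∪q ⊥ ⁅ i ⁆ (Subset.x∈⁅x⁆ i))))) _
  ... | no j≢i with lookup R j in r | lookup S j in s
  ...   | false | _     = _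
  ...   | true  | false = _
  ...   | true  | true  = contradiction
    (∣p∣≤1⇒x≡y (proj₁ (∈-singletonsIn⁻ {S = S} (nb ⁅ j ⁆ (⁅j⁆⊆ r)
        (∈-singletonsIn⁺ (ℕ.≤-reflexive (Subset.∣⁅x⁆∣≡1 j) , ⁅j⁆⊆ s)))))
      (Subset.p⊆p∪q ⁅ i ⁆ (Subset.x∈⁅x⁆ j)) (Subset.q⊆p∪q ⁅ j ⁆ ⁅ i ⁆ (Subset.x∈⁅x⁆ i))) j≢i
    where
    ⁅j⁆⊆ : ∀ {U} → lookup U j ≡ inside → ⁅ j ⁆ ⊆ U
    ⁅j⁆⊆ {U} eq x∈ = subst (_∈ U) (sym (Subset.x∈⁅y⁆⇒x≡y j x∈)) (lookup⇒[]= j U eq)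

  from : (∀ j → T (compatible i j (lookup R j) (lookup S j))) → NeverBlocked i R (singletonsIn S)
  from c I I⊆R I∈ = ∈-singletonsIn⁺
    ( ℕ.≤-trans (Subset.p⊆q⇒∣p∣≤∣q∣ I∪⁅i⁆⊆⁅i⁆) (ℕ.≤-reflexive (Subset.∣⁅x⁆∣≡1 i))
    , λ x∈ → subst (_∈ S) (sym (Subset.x∈⁅y⁆⇒x≡y i (I∪⁅i⁆⊆⁅i⁆ x∈))) i∈S)
    where
    i∈S : i ∈ S
    i∈S with i ≟ i | c i
    ... | yes _   | t = lookup⇒[]= i S (Equivalence.to Bool.T-≡ t)
    ... | no  i≢i | _ = contradiction refl i≢i
    I⊆⁅i⁆ : I ⊆ ⁅ i ⁆
    I⊆⁅i⁆ {j} j∈I with j ≟ i | c j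
    ... | yes refl | _ = Subset.x∈⁅x⁆ i
    ... | no  _    | t rewrite []=⇒lookup (I⊆R j∈I)
                             | []=⇒lookup (proj₂ (∈-singletonsIn⁻ {S = S} I∈) j∈I) = contradiction t λ ()
    I∪⁅i⁆⊆⁅i⁆ : I ∪ ⁅ i ⁆ ⊆ ⁅ i ⁆
    I∪⁅i⁆⊆⁅i⁆ x∈ with Subset.x∈p∪q⁻ I ⁅ i ⁆ x∈
    ... | inj₁ x∈I = I⊆⁅i⁆ x∈I
    ... | inj₂ x∈⁅i⁆ = x∈⁅i⁆

-- The probability of never being blocked, factored over the elements.

module _ {n} (x q : Vector ℚ n) (i : Fin n) where

  -- The conditional probability given the activity status `r` of `j`, over the choice of `S` alone;
  -- `unblockedProb` then averages it over `r`.
  compatibleProb : Fin n → Bool → ℚ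
  compatibleProb j r = bernoulli (q j) outside ℚ.* ⟦ compatible i j r outside ⟧
                 ℚ.+ bernoulli (q j) inside ℚ.* ⟦ compatible i j r inside ⟧

  unblockedProb : Fin n → ℚ
  unblockedProb j = bernoulli (x j) outside ℚ.* compatibleProb j outside
              ℚ.+ bernoulli (x j) inside ℚ.* compatibleProb j inside

  -- The left side is the shape of `selectProb` at one index. It factors in two rounds of
  -- `∑ℚSubset-∏`: over `S` with `R` fixed, then over `R`.
  ∑ℚSubset-unblocked :
    ∑ℚSubset (λ R → ∏ℚ (λ j → bernoulli (x j) (lookup R j)) ℚ.*
      ∑ℚSubset (λ S → ∏ℚ (λ j → bernoulli (q j) (lookup S j)) ℚ.*
        ⟦ does (neverBlocked? i R (singletonsIn S)) ⟧))
    ≡ ∏ℚ unblockedProb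
  ∑ℚSubset-unblocked = trans
    (∑ℚSubset-cong λ R → trans
      (cong (∏ℚ (λ j → bernoulli (x j) (lookup R j)) ℚ.*_) (∑ℚSubset-compatible R))
      (sym (∏-distrib-* (λ j → bernoulli (x j) (lookup R j))
                        (λ j → compatibleProb j (lookup R j)))))
    (∑ℚSubset-∏ (λ j r → bernoulli (x j) r ℚ.* compatibleProb j r))
    where
    indicator : ∀ R S → ⟦ does (neverBlocked? i R (singletonsIn S)) ⟧
                      ≡ ∏ℚ λ j → ⟦ compatible i j (lookup R j) (lookup S j) ⟧
    indicator R S = trans
      (cong ⟦_⟧ (does-⇔ (neverBlocked⇔ i R S) (neverBlocked? i R (singletonsIn S)) compatible?))
      (⟦⟧-∏ compatible?)
      where
      compatible? : Dec (∀ j → T (compatible i j (lookup R j) (lookup S j)))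
      compatible? = all? λ j → T? (compatible i j (lookup R j) (lookup S j))

    ∑ℚSubset-compatible : ∀ R →
      ∑ℚSubset (λ S → ∏ℚ (λ j → bernoulli (q j) (lookup S j)) ℚ.*
        ⟦ does (neverBlocked? i R (singletonsIn S)) ⟧)
      ≡ ∏ℚ λ j → compatibleProb j (lookup R j)
    ∑ℚSubset-compatible R = trans
      (∑ℚSubset-cong λ S → trans
        (cong (∏ℚ (λ j → bernoulli (q j) (lookup S j)) ℚ.*_) (indicator R S))
        (sym (∏-distrib-* (λ j → bernoulli (q j) (lookup S j))
                          (λ j → ⟦ compatible i j (lookup R j) (lookup S j) ⟧))))
      (∑ℚSubset-∏ (λ j s → bernoulli (q j) s ℚ.* ⟦ compatible i j (lookup R j) s ⟧))

-- Both kinds of factor are compared with the same value through `q = 1 - q (a ⁺)`. Only an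
-- inequality holds, because the activity weight uses `a` itself, which may be negative at this
-- index.
attenuate≤unblockedProb : ∀ {n} (x : Vector ℚ n) i j →
  attenuate (x j) ℚ.≤ unblockedProb x (λ k → attenuate (x k)) i j
attenuate≤unblockedProb x i j with j ≟ i
-- For `j = i` only membership in `S` counts, so both activity cases contribute `q` and `a` cancels.
... | yes _ = ℚ.≤-reflexive (solve 2 (λ a q → q :=
        (con 1ℚ :- a) :* ((con 1ℚ :- q) :* con 0ℚ :+ q :* con 1ℚ)
        :+ a :* ((con 1ℚ :- q) :* con 0ℚ :+ q :* con 1ℚ)) refl (x j) (attenuate (x j)))
  where open +-*-Solver
... | no _ = begin
  q
    ≤⟨ ≤-+-nonneg (*-nonneg (0≤attenuate a) (p≤q⇒0≤q-p (ℚ.p≤q⊔p 0ℚ a))) ⟩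
  q ℚ.+ q ℚ.* (a ⁺ ℚ.- a)
    ≡⟨ solve 3 (λ q a b → q :+ q :* (b :- a) := q :* (con 1ℚ :+ b) :- q :* a) refl q a (a ⁺) ⟩
  q ℚ.* (1ℚ ℚ.+ a ⁺) ℚ.- q ℚ.* a
    ≡⟨ cong (ℚ._- q ℚ.* a) (attenuate-inverse a) ⟩
  1ℚ ℚ.- q ℚ.* a
    ≡⟨ solve 2 (λ a q → con 1ℚ :- q :* a :=
         (con 1ℚ :- a) :* ((con 1ℚ :- q) :* con 1ℚ :+ q :* con 1ℚ)
         :+ a :* ((con 1ℚ :- q) :* con 1ℚ :+ q :* con 0ℚ)) refl a q ⟩
  _ ∎
  where
  open ℚ.≤-Reasoning
  open +-*-Solver
  a = x j
  q = attenuate a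

-- Reals in the unit interval

-- This bounds the representing sequence at every index, which is stronger than the inequalities
-- between reals. Attenuated values satisfy it, whereas the coordinates of `x` need not.
UnitInterval : ℝ → Set
UnitInterval q = ∀ m → 0ℚ ℚ.≤ seq q m × seq q m ℚ.≤ 1ℚ

unit-∣∣≤1 : ∀ {q} → UnitInterval q → ∀ m → ℚ.∣ seq q m ∣ ℚ.≤ 1ℚ
unit-∣∣≤1 q∈ m = 0≤p≤1⇒∣p∣≤1 (proj₁ (q∈ m)) (proj₂ (q∈ m))

unit-∏ : ∀ {n} (f : Vector ℝ n) → (∀ i → UnitInterval (f i)) → UnitInterval (∏ f)
unit-∏ {zero}  f f∈ m = 0≤1 , ℚ.≤-refl
unit-∏ {suc n} f f∈ m = let 0≤a , a≤1 = f∈ zero m ; 0≤b , b≤1 = unit-∏ (f ∘ suc) (f∈ ∘ suc) m in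
  *-nonneg 0≤a 0≤b , *-mono-≤ 0≤a a≤1 0≤b b≤1

unit-1- : ∀ {q} → UnitInterval q → UnitInterval (1ℝ - q)
unit-1- {q} q∈ m = p≤q⇒0≤q-p (proj₂ (q∈ m)) ,
  ℚ.+-monoʳ-≤ 1ℚ (ℚ.neg-antimono-≤ (proj₁ (q∈ m)))

unit-if : ∀ b {x y} → UnitInterval x → UnitInterval y → UnitInterval (if b then x else y)
unit-if true  x∈ y∈ = x∈
unit-if false x∈ y∈ = y∈

unit-activeProb : ∀ {n} (q : Vector ℝ n) → (∀ i → UnitInterval (q i)) → ∀ S → UnitInterval (activeProb q S)
unit-activeProb q q∈ S = unit-∏ (λ i → if lookup S i then q i else 1ℝ - q i)
  λ i → unit-if (lookup S i) (q∈ i) (unit-1- {q i} (q∈ i))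

½*-pos : ∀ {ε} → 0ℚ ℚ.< ε → 0ℚ ℚ.< ℚ.½ ℚ.* ε
½*-pos = ℚ.*-monoʳ-<-pos ℚ.½

½*+½* : ∀ ε → ℚ.½ ℚ.* ε ℚ.+ ℚ.½ ℚ.* ε ≡ ε
½*+½* ε = trans (sym (ℚ.*-distribʳ-+ ε ℚ.½ ℚ.½)) (ℚ.*-identityˡ ε)

≃-refl : ∀ {x} → x ≃ x
≃-refl {x} ε 0<ε = 0 , λ n _ → subst (ℚ._< ε) (sym (cong ℚ.∣_∣ (ℚ.+-inverseʳ (seq x n)))) 0<ε

≃-from-sum : ∀ {x y u v w z : ℝ} → x ≃ y → u ≃ v →
  (∀ n → ℚ.∣ seq w n ℚ.- seq z n ∣ ℚ.≤ ℚ.∣ seq x n ℚ.- seq y n ∣ ℚ.+ ℚ.∣ seq u n ℚ.- seq v n ∣) →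
  w ≃ z
≃-from-sum {x} {y} {u} {v} {w} {z} x≃y u≃v bound ε 0<ε
  with x≃y (ℚ.½ ℚ.* ε) (½*-pos 0<ε) | u≃v (ℚ.½ ℚ.* ε) (½*-pos 0<ε)
... | N , hN | M , hM = N ℕ.⊔ M , λ n N⊔M≤n → ℚ.≤-<-trans (bound n)
  (subst (_ ℚ.<_) (½*+½* ε) (ℚ.+-mono-< (hN n (ℕ.m⊔n≤o⇒m≤o N M N⊔M≤n)) (hM n (ℕ.m⊔n≤o⇒n≤o N M N⊔M≤n))))

+-cong-≃ : ∀ {x y u v} → x ≃ y → u ≃ v → x + u ≃ y + v
+-cong-≃ {x} {y} {u} {v} x≃y u≃v = ≃-from-sum {x} {y} {u} {v} {x + u} {y + v} x≃y u≃v λ n →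
  ℚ.≤-trans (ℚ.≤-reflexive (cong ℚ.∣_∣
    (solve 4 (λ x y u v → (x :+ u) :- (y :+ v) := (x :- y) :+ (u :- v)) refl
      (seq x n) (seq y n) (seq u n) (seq v n))))
    (ℚ.∣p+q∣≤∣p∣+∣q∣ (seq x n ℚ.- seq y n) (seq u n ℚ.- seq v n))
  where open +-*-Solver

-- From `x u - y v = (x - y) u + y (u - v)`, only `y` and `u` need a bound. The bound 1 keeps the
-- error from growing, so no rescaling of ε is required.
*-cong-≃ : ∀ {x y u v} → (∀ n → ℚ.∣ seq y n ∣ ℚ.≤ 1ℚ) → (∀ n → ℚ.∣ seq u n ∣ ℚ.≤ 1ℚ) →
           x ≃ y → u ≃ v → x * u ≃ y * v
*-cong-≃ {x} {y} {u} {v} ∣y∣≤1 ∣u∣≤1 x≃y u≃v = ≃-from-sum {x} {y} {u} {v} {x * u} {y * v} x≃y u≃v λ n →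
  let a = seq x n ; b = seq y n ; c = seq u n ; d = seq v n in begin
  ℚ.∣ a ℚ.* c ℚ.- b ℚ.* d ∣
    ≡⟨ cong ℚ.∣_∣ (solve 4 (λ x y u v → x :* u :- y :* v := (x :- y) :* u :+ y :* (u :- v)) refl a b c d) ⟩
  ℚ.∣ (a ℚ.- b) ℚ.* c ℚ.+ b ℚ.* (c ℚ.- d) ∣
    ≤⟨ ℚ.∣p+q∣≤∣p∣+∣q∣ ((a ℚ.- b) ℚ.* c) (b ℚ.* (c ℚ.- d)) ⟩
  ℚ.∣ (a ℚ.- b) ℚ.* c ∣ ℚ.+ ℚ.∣ b ℚ.* (c ℚ.- d) ∣
    ≤⟨ ℚ.+-mono-≤ (∣-∣-*-mono (a ℚ.- b) c ℚ.≤-refl (∣u∣≤1 n)) (∣-∣-*-mono b (c ℚ.- d) (∣y∣≤1 n) ℚ.≤-refl) ⟩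
  ℚ.∣ a ℚ.- b ∣ ℚ.* 1ℚ ℚ.+ 1ℚ ℚ.* ℚ.∣ c ℚ.- d ∣
    ≡⟨ cong₂ ℚ._+_ (ℚ.*-identityʳ ℚ.∣ a ℚ.- b ∣) (ℚ.*-identityˡ ℚ.∣ c ℚ.- d ∣) ⟩
  ℚ.∣ a ℚ.- b ∣ ℚ.+ ℚ.∣ c ℚ.- d ∣ ∎
  where
  open ℚ.≤-Reasoning
  open +-*-Solver

1--cong-≃ : ∀ {x y} → x ≃ y → 1ℝ - x ≃ 1ℝ - y
1--cong-≃ {x} {y} x≃y ε 0<ε with x≃y ε 0<ε
... | N , h = N , λ n N≤n → subst (ℚ._< ε)
  (trans (∣-∣-sub-comm (seq x n) (seq y n)) (cong ℚ.∣_∣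
    (solve 2 (λ x y → y :- x := (con 1ℚ :- x) :- (con 1ℚ :- y)) refl (seq x n) (seq y n)))) (h n N≤n)
  where open +-*-Solver

if-cong-≃ : ∀ b {x y u v} → x ≃ y → u ≃ v → (if b then x else u) ≃ (if b then y else v)
if-cong-≃ true  x≃y u≃v = x≃y
if-cong-≃ false x≃y u≃v = u≃v

∑-cong-≃ : ∀ {n} (f g : Vector ℝ n) → (∀ i → f i ≃ g i) → ∑ f ≃ ∑ g
∑-cong-≃ {zero}  f g f≃g = ≃-refl {0ℝ}
∑-cong-≃ {suc n} f g f≃g = +-cong-≃ {f zero} {g zero} {∑ (f ∘ suc)} {∑ (g ∘ suc)}
  (f≃g zero) (∑-cong-≃ (f ∘ suc) (g ∘ suc) (f≃g ∘ suc))

∏-cong-≃ : ∀ {n} (f g : Vector ℝ n) → (∀ i → UnitInterval (f i)) → (∀ i → UnitInterval (g i)) →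
           (∀ i → f i ≃ g i) → ∏ f ≃ ∏ g
∏-cong-≃ {zero}  f g f∈ g∈ f≃g = ≃-refl {1ℝ}
∏-cong-≃ {suc n} f g f∈ g∈ f≃g = *-cong-≃ {f zero} {g zero} {∏ (f ∘ suc)} {∏ (g ∘ suc)}
  (unit-∣∣≤1 {g zero} (g∈ zero)) (unit-∣∣≤1 {∏ (f ∘ suc)} (unit-∏ (f ∘ suc) (f∈ ∘ suc)))
  (f≃g zero) (∏-cong-≃ (f ∘ suc) (g ∘ suc) (f∈ ∘ suc) (g∈ ∘ suc) (f≃g ∘ suc))

activeProb-cong-≃ : ∀ {n} (p q : Vector ℝ n) → (∀ i → UnitInterval (p i)) → (∀ i → UnitInterval (q i)) →
                    (∀ i → p i ≃ q i) → ∀ S → activeProb p S ≃ activeProb q S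
activeProb-cong-≃ p q p∈ q∈ p≃q S = ∏-cong-≃
  (λ i → if lookup S i then p i else 1ℝ - p i) (λ i → if lookup S i then q i else 1ℝ - q i)
  (λ i → unit-if (lookup S i) (p∈ i) (unit-1- {p i} (p∈ i)))
  (λ i → unit-if (lookup S i) (q∈ i) (unit-1- {q i} (q∈ i)))
  (λ i → if-cong-≃ (lookup S i) {p i} {q i} {1ℝ - p i} {1ℝ - q i} (p≃q i) (1--cong-≃ {p i} {q i} (p≃q i)))

unit-𝟙 : ∀ {A : Set} (d : Dec A) → UnitInterval (𝟙 d)
unit-𝟙 d = unit-if (does d) (λ _ → 0≤1 , ℚ.≤-refl) (λ _ → ℚ.≤-refl , 0≤1)

≤-from-pointwise : ∀ {x y} → (∀ m → seq x m ℚ.≤ seq y m) → x ≤ y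
≤-from-pointwise {x} {y} x≤y ε 0<ε = 0 , λ m _ →
  subst (ℚ._< seq y m ℚ.+ ε) (ℚ.+-identityʳ (seq x m)) (ℚ.+-mono-≤-< (x≤y m) 0<ε)

≃-from-pointwise : ∀ {x y} → (∀ m → seq x m ≡ seq y m) → x ≃ y
≃-from-pointwise {x} {y} x≡y ε 0<ε = 0 , λ m _ →
  subst (ℚ._< ε) (sym (cong ℚ.∣_∣ (trans (cong (ℚ._- seq y m) (x≡y m)) (ℚ.+-inverseʳ (seq y m))))) 0<ε

-- The law of the random family and the selection probability.

∑ℚSubset-bernoulli : ∀ {n} (q : Vector ℚ n) →
  ∑ℚSubset (λ S → ∏ℚ λ j → bernoulli (q j) (lookup S j)) ≡ 1ℚ
∑ℚSubset-bernoulli {n} q = trans (∑ℚSubset-∏ (λ j → bernoulli (q j))) (trans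
  (∏-cong λ j → solve 1 (λ q → (con 1ℚ :- q) :+ q := con 1ℚ) refl (q j)) (∏-one n))
  where open +-*-Solver

randomFamily : ∀ {n} (q : Vector ℝ n) → (∀ i → UnitInterval (q i)) →
               Random (GreedyFamily (SingleItem n))
randomFamily {n} q q∈ = record
  { size    = #subsets n
  ; outcome = singletonsIn ∘ subsets n
  ; prob    = activeProb q ∘ subsets n
  ; prob≥0  = λ k → ≤-from-pointwise {0ℝ} {activeProb q (subsets n k)}
                λ m → proj₁ (unit-activeProb q q∈ (subsets n k) m)
  ; ∑prob≃1 = ≃-from-pointwise {∑ (activeProb q ∘ subsets n)} {1ℝ} λ m → begin
      seq (∑ (activeProb q ∘ subsets n)) m
        ≡⟨ seq-∑ (activeProb q ∘ subsets n) m ⟩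
      ∑ℚ (λ k → seq (activeProb q (subsets n k)) m)
        ≡⟨ ∑ℚ-subsets (λ S → seq (activeProb q S) m) ⟩
      ∑ℚSubset (λ S → seq (activeProb q S) m)
        ≡⟨ ∑ℚSubset-cong (λ S → seq-activeProb q S m) ⟩
      ∑ℚSubset (λ S → ∏ℚ λ j → bernoulli (seq (q j) m) (lookup S j))
        ≡⟨ ∑ℚSubset-bernoulli (λ j → seq (q j) m) ⟩
      1ℚ ∎
  }
  where open ≡-Reasoning

seq-Pr-randomFamily : ∀ {n} (q : Vector ℝ n) (q∈ : ∀ i → UnitInterval (q i))
  {Q : Pred (GreedyFamily (SingleItem n)) 0ℓ} (Q? : Decidable Q) m →
  seq (Pr (randomFamily q q∈) Q?) m ≡
  ∑ℚSubset λ S → ∏ℚ (λ j → bernoulli (seq (q j) m) (lookup S j)) ℚ.* ⟦ does (Q? (singletonsIn S)) ⟧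
seq-Pr-randomFamily {n} q q∈ Q? m = begin
  seq (Pr (randomFamily q q∈) Q?) m
    ≡⟨ seq-∑ (λ k → term (subsets n k)) m ⟩
  ∑ℚ (λ k → seq (term (subsets n k)) m)
    ≡⟨ ∑ℚ-subsets (λ S → seq (term S) m) ⟩
  ∑ℚSubset (λ S → seq (term S) m)
    ≡⟨ ∑ℚSubset-cong (λ S → cong₂ ℚ._*_ (seq-activeProb q S m) (seq-if (does (Q? (singletonsIn S))) 1ℝ 0ℝ m)) ⟩
  _ ∎
  where
  open ≡-Reasoning
  term : Subset n → ℝ
  term S = activeProb q S * 𝟙 (Q? (singletonsIn S))

seq-selectProb : ∀ {n} (x q : Vector ℝ n) (q∈ : ∀ i → UnitInterval (q i)) i m →
  seq (selectProb x (randomFamily q q∈) i) m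
    ≡ ∏ℚ (unblockedProb (λ j → seq (x j) m) (λ j → seq (q j) m) i)
seq-selectProb x q q∈ i m = trans
  (seq-∑Subset (λ R → activeProb x R * Pr (randomFamily q q∈) (neverBlocked? i R)) m)
  (trans (∑ℚSubset-cong λ R → cong₂ ℚ._*_ (seq-activeProb x R m)
           (seq-Pr-randomFamily q q∈ (neverBlocked? i R) m))
         (∑ℚSubset-unblocked (λ j → seq (x j) m) (λ j → seq (q j) m) i))

-- The scheme on real vectors.

attenuateℝ : ℝ → ℝ
attenuateℝ x = mkℝ (λ m → attenuate (seq x m)) λ ε 0<ε → let N , h = cauchy x ε 0<ε in
  N , λ m n N≤m N≤n → ℚ.≤-<-trans (attenuate-1-Lipschitz (seq x m) (seq x n)) (h m n N≤m N≤n)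

attenuateℝ-cong : ∀ {x y} → x ≃ y → attenuateℝ x ≃ attenuateℝ y
attenuateℝ-cong {x} {y} x≃y ε 0<ε = let N , h = x≃y ε 0<ε in
  N , λ n N≤n → ℚ.≤-<-trans (attenuate-1-Lipschitz (seq x n) (seq y n)) (h n N≤n)

unit-attenuateℝ : ∀ x → UnitInterval (attenuateℝ x)
unit-attenuateℝ x m = 0≤attenuate (seq x m) , attenuate≤1 (seq x m)

-- All `x` share the same list of outcomes and differ only in the weights, so the two laws in
-- `family-cong` can be compared term by term.
attenuationOCRS : ∀ n → RandomizedGreedyOCRS (SingleItem n) (SingleItemPolytope n)
attenuationOCRS n = record
  { family      = λ x _ → randomFamily (λ i → attenuateℝ (x i)) (λ i → unit-attenuateℝ (x i))
  ; family-cong = λ x y _ _ x≃y h →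
      let p = λ i → attenuateℝ (x i)
          q = λ i → attenuateℝ (y i)
          p∈ = λ i → unit-attenuateℝ (x i)
          q∈ = λ i → unit-attenuateℝ (y i)
          χ = λ k → 𝟙 (hasMembers? h (singletonsIn (subsets n k)))
      in ∑-cong-≃ (λ k → activeProb p (subsets n k) * χ k) (λ k → activeProb q (subsets n k) * χ k)
        λ k → *-cong-≃ {activeProb p (subsets n k)} {activeProb q (subsets n k)} {χ k} {χ k}
          (unit-∣∣≤1 {activeProb q (subsets n k)} (unit-activeProb q q∈ (subsets n k)))
          (unit-∣∣≤1 {χ k} (unit-𝟙 (hasMembers? h (singletonsIn (subsets n k)))))
          (activeProb-cong-≃ p q p∈ q∈ (λ i → attenuateℝ-cong {x i} {y i} (x≃y i)) (subsets n k))
          (≃-refl {χ k})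
  }

-- From rational bounds at large indices to inequalities between reals.

∑-⁺-bound : ∀ {n} (x : Vector ℝ n) → (∀ i → 0ℝ ≤ x i) → ∀ ε → 0ℚ ℚ.< ε →
  ∃ λ N → ∀ m → N ℕ.≤ m → ∑ℚ (λ i → seq (x i) m ⁺) ℚ.≤ ∑ℚ (λ i → seq (x i) m) ℚ.+ ε
∑-⁺-bound {zero}  x 0≤x ε 0<ε = 0 , λ m _ → ℚ.+-mono-≤ (ℚ.≤-refl {0ℚ}) (ℚ.<⇒≤ 0<ε)
∑-⁺-bound {suc n} x 0≤x ε 0<ε
  with 0≤x zero (ℚ.½ ℚ.* ε) (½*-pos 0<ε) | ∑-⁺-bound (x ∘ suc) (0≤x ∘ suc) (ℚ.½ ℚ.* ε) (½*-pos 0<ε)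
... | N , hN | M , hM = N ℕ.⊔ M , λ m N⊔M≤m →
  let a = seq (x zero) m
      s = ∑ℚ λ i → seq (x (suc i)) m
      η = ℚ.½ ℚ.* ε
  in begin
  a ⁺ ℚ.+ ∑ℚ (λ i → seq (x (suc i)) m ⁺)
    -- Nonnegativity of the real says only that eventually `0 < a + η`, whence `a ⁺ ≤ a + η`. The
    -- remaining half of ε is left for the other coordinates.
    ≤⟨ ℚ.+-mono-≤ (ℚ.⊔-lub (ℚ.<⇒≤ (hN m (ℕ.m⊔n≤o⇒m≤o N M N⊔M≤m))) (≤-+-nonneg {a} (ℚ.<⇒≤ (½*-pos 0<ε))))
                  (hM m (ℕ.m⊔n≤o⇒n≤o N M N⊔M≤m)) ⟩
  (a ℚ.+ η) ℚ.+ (s ℚ.+ η)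
    ≡⟨ solve 3 (λ a s η → (a :+ η) :+ (s :+ η) := (a :+ s) :+ (η :+ η)) refl a s η ⟩
  (a ℚ.+ s) ℚ.+ (η ℚ.+ η)
    ≡⟨ cong ((a ℚ.+ s) ℚ.+_) (½*+½* ε) ⟩
  (a ℚ.+ s) ℚ.+ ε ∎
  where
  open ℚ.≤-Reasoning
  open +-*-Solver

n/n≡1 : ∀ n → + suc n ℚ./ suc n ≡ 1ℚ
n/n≡1 n = ℚ.fromℚᵘ-cong {ℚᵘ.mkℚᵘ (+ suc n) n} {ℚᵘ.1ℚᵘ} (ℚᵘ.*≡* (ℤ.*-comm (+ suc n) (+ 1)))

·-archimedean : ∀ n ε → 0ℚ ℚ.< ε → ∃ λ δ → 0ℚ ℚ.< δ × n · δ ℚ.< ε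
·-archimedean n ε 0<ε = δ , 0<δ , (begin-strict
  n · δ              ≡⟨ ℚ.+-identityˡ (n · δ) ⟨
  0ℚ ℚ.+ n · δ       <⟨ ℚ.+-monoˡ-< (n · δ) 0<δ ⟩
  suc n · δ          ≡⟨ ×-assoc-* (suc n) d ε ⟨
  (suc n · d) ℚ.* ε  ≡⟨ cong (ℚ._* ε) (trans (·-1/ (suc n) (suc n)) (n/n≡1 n)) ⟩
  1ℚ ℚ.* ε           ≡⟨ ℚ.*-identityˡ ε ⟩
  ε                  ∎)
  where
  open ℚ.≤-Reasoning
  -- Dividing by `suc n` instead of `n` makes the inequality strict and covers `n = 0`.
  d = + 1 ℚ./ suc n
  δ = d ℚ.* ε
  0<δ : 0ℚ ℚ.< δ
  0<δ = ℚ.positive⁻¹ δ {{ℚ.pos*pos⇒pos d {{ℚ.normalize-pos 1 (suc n)}} ε {{ℚ.positive 0<ε}}}}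

1/e≤∏-attenuateℝ : ∀ {n} (x : Vector ℝ n) → (∀ i → 0ℝ ≤ x i) → ∑ x ≤ 1ℝ →
                   1/e ≤ ∏ (λ i → attenuateℝ (x i))
1/e≤∏-attenuateℝ {n} x 0≤x ∑x≤1 ε 0<ε =
  let δ , 0<δ , nδ<ε = ·-archimedean n ε 0<ε
      -- One half of δ pays for passing to positive parts, the other for the sum of the coordinates
      -- exceeding 1.
      N , hN = ∑-⁺-bound x 0≤x (ℚ.½ ℚ.* δ) (½*-pos 0<δ)
      M , hM = ∑x≤1 (ℚ.½ ℚ.* δ) (½*-pos 0<δ)
  in n ℕ.⊔ (N ℕ.⊔ M) , λ m large →
    let n≤m = ℕ.m⊔n≤o⇒m≤o n (N ℕ.⊔ M) large
        N⊔M≤m = ℕ.m⊔n≤o⇒n≤o n (N ℕ.⊔ M) large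
    in bound δ 0<δ nδ<ε m n≤m (hN m (ℕ.m⊔n≤o⇒m≤o N M N⊔M≤m)) (hM m (ℕ.m⊔n≤o⇒n≤o N M N⊔M≤m))
  where
  open ℚ.≤-Reasoning
  bound : ∀ δ → 0ℚ ℚ.< δ → n · δ ℚ.< ε → ∀ m → n ℕ.≤ m →
    ∑ℚ (λ j → seq (x j) m ⁺) ℚ.≤ ∑ℚ (λ j → seq (x j) m) ℚ.+ ℚ.½ ℚ.* δ →
    seq (∑ x) m ℚ.< 1ℚ ℚ.+ ℚ.½ ℚ.* δ →
    seq 1/e m ℚ.< seq (∏ (λ i → attenuateℝ (x i))) m ℚ.+ ε
  bound δ 0<δ nδ<ε m n≤m ∑⁺≤ ∑< = begin-strict
    seq 1/e m
      ≤⟨ 1/e≤∏-attenuate a n≤m (ℚ.<⇒≤ 0<δ) (begin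
           ∑ℚ (λ j → a j ⁺)       ≤⟨ ∑⁺≤ ⟩
           ∑ℚ a ℚ.+ η             ≡⟨ cong (ℚ._+ η) (seq-∑ x m) ⟨
           seq (∑ x) m ℚ.+ η      ≤⟨ ℚ.+-monoˡ-≤ η (ℚ.<⇒≤ ∑<) ⟩
           (1ℚ ℚ.+ η) ℚ.+ η       ≡⟨ trans (ℚ.+-assoc 1ℚ η η) (cong (1ℚ ℚ.+_) (½*+½* δ)) ⟩
           1ℚ ℚ.+ δ ∎) ⟩
    ∏ℚ (λ j → attenuate (a j)) ℚ.+ n · δ
      <⟨ ℚ.+-monoʳ-< (∏ℚ λ j → attenuate (a j)) nδ<ε ⟩
    ∏ℚ (λ j → attenuate (a j)) ℚ.+ ε
      ≡⟨ cong (ℚ._+ ε) (seq-∏ (λ i → attenuateℝ (x i)) m) ⟨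
    seq (∏ (λ i → attenuateℝ (x i))) m ℚ.+ ε ∎
    where
    η = ℚ.½ ℚ.* δ
    a : Vector ℚ n
    a j = seq (x j) m

∏-attenuateℝ≤selectProb : ∀ {n} (x : Vector ℝ n) i m →
  seq (∏ (λ j → attenuateℝ (x j))) m ℚ.≤
  seq (selectProb x (randomFamily (λ j → attenuateℝ (x j)) (λ j → unit-attenuateℝ (x j))) i) m
∏-attenuateℝ≤selectProb x i m = subst₂ ℚ._≤_
  (sym (seq-∏ (λ j → attenuateℝ (x j)) m))
  (sym (seq-selectProb x (λ j → attenuateℝ (x j)) (λ j → unit-attenuateℝ (x j)) i m))
  (∏-mono-≤ (λ j → attenuate (seq (x j) m))
    (unblockedProb (λ j → seq (x j) m) (λ j → attenuate (seq (x j) m)) i)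
    (λ j → 0≤attenuate (seq (x j) m)) (attenuate≤unblockedProb (λ j → seq (x j) m) i))

theorem1p1 : (n : ℕ) →
    Σ[ π ∈ RandomizedGreedyOCRS (SingleItem n) (SingleItemPolytope n) ]
    Selectable 1/e π
theorem1p1 n = attenuationOCRS n , λ x (0≤x , _ , ∑x≤1) i ε 0<ε →
  let N , h = 1/e≤∏-attenuateℝ x 0≤x ∑x≤1 ε 0<ε
  in N , λ m N≤m → ℚ.<-≤-trans (h m N≤m) (ℚ.+-monoˡ-≤ ε (∏-attenuateℝ≤selectProb x i m))
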